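{- For every integer $n\ge 1$: $$\overline{N}(0,2,n)>\overline{N}(1,2,n)\quad\text{if } n \text{ is odd},$$ $$\overline{N}(0,2,n)<\overline{N}(1,2,n)\quad\text{if } n \text{ is even}.$$
   Context: An overpartition of a positive integer $n$ is a partition of $n$ (a non-increasing sequence of positive integers with sum $n$) in which the first occurrence of each distinct part may or may not be overlined; thus a partition with $d$ distinct part sizes gives rise to $2^d$ overpartitions. The rank of an overpartition is its largest part minus its number of parts (overlines are ignored). $\overline{N}(a,c,n)$ denotes the number of overpartitions of $n$ whose rank is congruent to $a$ modulo $c$. -}

module Defs where

open import Data.Bool using (Bool; true; false)
import Data.Bool.Properties as Bool
open import Data.Integer as ℤ using (ℤ; +_)
import Data.Integer.Divisibility as ℤ
open import Data.List using (List; []; _∷_; map; length; filter; upTo;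
  cartesianProduct; cartesianProductWith)
open import Data.List.Extrema.Nat using (max)
open import Data.List.Membership.Propositional using (_∈_)
open import Data.List.Membership.Propositional.Properties
  using (∈-filter⁺; ∈-filter⁻; ∈-cartesianProduct⁺; ∈-cartesianProductWith⁺;
         ∈-cartesianProductWith⁻; ∈-upTo⁺)
open import Data.List.Properties using (∷-injective)
open import Data.List.Relation.Unary.All as All using (All; []; _∷_; all?)
open import Data.List.Relation.Unary.AllPairs using ([]; _∷_)
open import Data.List.Relation.Unary.Any using (here; there)
open import Data.List.Relation.Unary.Linked using (Linked; linked?)
open import Data.List.Relation.Unary.Unique.Propositional using (Unique)
import Data.List.Relation.Unary.Unique.Propositional.Properties as Unique
open import Data.Nat using (ℕ; zero; suc; _≤_; z≤n; s≤s; _≤?_; _≟_)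
open import Data.Nat.Divisibility using (_∣?_)
open import Data.Nat.ListAction using (sum)
open import Data.Nat.Properties using (≤-trans; ≤-refl; +-mono-≤; m≤m+n; m≤n+m)
open import Data.Product using (_×_; _,_; proj₁; proj₂)
open import Function using (_∘_; _⇔_; mk⇔)
open import Relation.Binary.PropositionalEquality using (_≡_; _≢_; refl)
open import Relation.Nullary using (Dec)
open import Relation.Nullary.Decidable using (map′; _×-dec_; _→-dec_)

-- A part together with a flag telling whether it is overlined.
Part : Set
Part = ℕ × Bool

size : Part → ℕ
size = proj₁

overlined : Part → Bool
overlined = proj₂

-- Relation between neighbouring parts.  In a non-increasing sequence a part is
-- a repeated occurrence of its size exactly when it equals its predecessor;
-- such a part may not be overlined.
infix 4 _≽_
_≽_ : Part → Part → Set
p ≽ q = size q ≤ size p × (size q ≡ size p → overlined q ≡ false)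

record IsOverpartition (n : ℕ) (ps : List Part) : Set where
  constructor isOverpartition
  field
    positive      : All (λ p → 1 ≤ size p) ps
    nonincreasing : Linked _≽_ ps
    sums-to       : sum (map size ps) ≡ n

_≽?_ : ∀ p q → Dec (p ≽ q)
p ≽? q = (size q ≤? size p) ×-dec ((size q ≟ size p) →-dec (overlined q Bool.≟ false))

isOverpartition? : ∀ n ps → Dec (IsOverpartition n ps)
isOverpartition? n ps = map′
  (λ (p , l , s) → isOverpartition p l s)
  (λ (isOverpartition p l s) → p , l , s)
  (all? (λ p → 1 ≤? size p) ps ×-dec linked? _≽?_ ps ×-dec (sum (map size ps) ≟ n))

listsUpTo : {A : Set} → ℕ → List A → List (List A)
listsUpTo zero    as = [] ∷ []
listsUpTo (suc k) as = [] ∷ cartesianProductWith _∷_ as (listsUpTo k as)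

partsUpTo : ℕ → List Part
partsUpTo n = cartesianProduct (upTo (suc n)) (false ∷ true ∷ [])

-- An overpartition of n has at most n parts, each of size at most n, so
-- filtering these candidates finds each overpartition exactly once; see
-- ∈-overpartitions and overpartitions-unique below.
overpartitions : ℕ → List (List Part)
overpartitions n = filter (isOverpartition? n) (listsUpTo n (partsUpTo n))

-- For the empty sequence max returns the default 0; this only concerns n = 0.
largestPart : List Part → ℕ
largestPart ps = max 0 (map size ps)

rank : List Part → ℤ
rank ps = + largestPart ps ℤ.- + length ps

infix 4 _≡_[mod_]
_≡_[mod_] : ℤ → ℤ → ℕ → Set
i ≡ j [mod c ] = + c ℤ.∣ i ℤ.- j

_≡?_[mod_] : ∀ i j c → Dec (i ≡ j [mod c ])
i ≡? j [mod c ] = c ∣? ℤ.∣ i ℤ.- j ∣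

N̄ : ℕ → ℕ → ℕ → ℕ
N̄ a c n = length (filter (λ ps → rank ps ≡? + a [mod c ]) (overpartitions n))

module _ {A : Set} where

  listsUpTo-unique : ∀ k {as : List A} → Unique as → Unique (listsUpTo k as)
  listsUpTo-unique zero    _  = [] ∷ []
  listsUpTo-unique (suc k) {as} as! =
    All.tabulate []≢ ∷
    Unique.cartesianProductWith⁺ _∷_ ∷-injective as! (listsUpTo-unique k as!)
    where
    []≢ : ∀ {xs} → xs ∈ cartesianProductWith _∷_ as (listsUpTo k as) → [] ≢ xs
    []≢ xs∈ refl with ∈-cartesianProductWith⁻ _∷_ as (listsUpTo k as) xs∈
    ... | _ , _ , _ , _ , ()

  ∈-listsUpTo : ∀ k {as xs : List A} → length xs ≤ k → All (_∈ as) xs → xs ∈ listsUpTo k as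
  ∈-listsUpTo zero    {xs = []}     _         _            = here refl
  ∈-listsUpTo (suc k) {xs = []}     _         _            = here refl
  ∈-listsUpTo (suc k) {xs = x ∷ xs} (s≤s len) (x∈as ∷ all) =
    there (∈-cartesianProductWith⁺ _∷_ x∈as (∈-listsUpTo k len all))

partsUpTo-unique : ∀ n → Unique (partsUpTo n)
partsUpTo-unique n =
  Unique.cartesianProduct⁺ (Unique.upTo⁺ (suc n)) (((λ ()) ∷ []) ∷ [] ∷ [])

∈-partsUpTo : ∀ {n} p → size p ≤ n → p ∈ partsUpTo n
∈-partsUpTo (m , false) m≤n = ∈-cartesianProduct⁺ (∈-upTo⁺ (s≤s m≤n)) (here refl)
∈-partsUpTo (m , true)  m≤n = ∈-cartesianProduct⁺ (∈-upTo⁺ (s≤s m≤n)) (there (here refl))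

length≤sum : ∀ {ps} → All (λ p → 1 ≤ size p) ps → length ps ≤ sum (map size ps)
length≤sum []         = z≤n
length≤sum (pos ∷ ps) = +-mono-≤ pos (length≤sum ps)

sizes≤sum : ∀ ps {n} → sum (map size ps) ≤ n → All (λ p → size p ≤ n) ps
sizes≤sum []       _  = []
sizes≤sum (p ∷ ps) s≤ =
  ≤-trans (m≤m+n (size p) _) s≤ ∷ sizes≤sum ps (≤-trans (m≤n+m _ (size p)) s≤)

∈-overpartitions : ∀ {n ps} → ps ∈ overpartitions n ⇔ IsOverpartition n ps
∈-overpartitions {n} {ps} = mk⇔
  (proj₂ ∘ ∈-filter⁻ (isOverpartition? n) {xs = listsUpTo n (partsUpTo n)})
  (λ o → ∈-filter⁺ (isOverpartition? n) (candidate o) o)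
  where
  candidate : IsOverpartition n ps → ps ∈ listsUpTo n (partsUpTo n)
  candidate (isOverpartition pos _ refl) = ∈-listsUpTo n (length≤sum pos)
    (All.map (λ {p} → ∈-partsUpTo p) (sizes≤sum ps ≤-refl))

overpartitions-unique : ∀ n → Unique (overpartitions n)
overpartitions-unique n =
  Unique.filter⁺ (isOverpartition? n) (listsUpTo-unique n (partsUpTo-unique n))

{-# OPTIONS --safe #-}

-- Removing one copy of the largest part ℓ, the sign (−1)^(rank + n + 1) of an
-- overpartition of n is the product of (−1)^(j+1) over the remaining parts j.  Hence
-- (−1)^(n+1) (N̄(0,2,n) − N̄(1,2,n)) is the coefficient of q^n in
--   G = Σ_{ℓ≥1} 2 q^ℓ/(1 − s_ℓ q^ℓ) Π_{j<ℓ} (1 + s_j q^j)/(1 − s_j q^j),   s_j = (−1)^(j+1).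
-- With Q = q² and e_m = q^(2m²) Σ_{|d|≤m} q^(−d²), where the terms d = ±m count half,
--   G = Σ_{m≥1} (4 e_m (1 + Q^m)/(1 − Q^m) − 2 q^(m²)),
-- a Hecke-type expansion all of whose summands have nonnegative coefficients, and already
-- the summand m = 1 has positive ones.  Partial sums of G telescope except for the
-- products with odd ℓ, which are finite Jacobi triple products; summation by parts over m
-- turns these into finite forms of the Hecke sum, with the weights
-- (Q;Q)_M² / ((Q;Q)_{M−m} (Q;Q)_{M+m}).  Each weight is congruent to 1 modulo a power of q
-- high enough, given the order m² of e_m, for the M-th identity to determine the
-- coefficients of G up to q^(2M).
module Submission where

open import Defs
open import Data.Nat using (ℕ; _≥_; _<_; _>_)
open import Data.Nat.Divisibility using (_∣_)
open import Data.Product using (_×_)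
open import Relation.Nullary using (¬_)

open import Algebra.Bundles using (CommutativeRing)
import Algebra.Solver.Ring
import Algebra.Solver.Ring.AlmostCommutativeRing as ACR
open import Data.Bool using (Bool; true; false; if_then_else_)
open import Data.Integer as ℤ using (ℤ; +_; 0ℤ; 1ℤ; -1ℤ)
import Data.Integer.Properties as ℤ
import Data.Integer.Solver
open import Data.List using (List; []; _∷_; _++_; map; length; filter; upTo; cartesianProductWith)
open import Data.List.Extrema.Nat using (max≈v⁺)
open import Data.List.Properties using (upTo-∷ʳ)
open import Data.List.Relation.Unary.All as All using (All; []; _∷_)
open import Data.List.Relation.Unary.Any using (here)
open import Data.List.Relation.Unary.Linked using (Linked; [-]; _∷_)
open import Data.Maybe as Maybe using ()
open import Data.Nat as ℕ using (zero; suc; _∸_; _≤_; z≤n; s≤s; _≤?_)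
open import Data.Nat.Divisibility using (divides; _∣?_; ∣m+n∣m⇒∣n; ∣m∣n⇒∣m+n; ∣-refl)
open import Data.Nat.ListAction using (sum)
import Data.Nat.Properties as ℕ
open import Data.Product using (∃-syntax; _,_; proj₁; proj₂)
open import Data.Sum using (_⊎_; inj₁; inj₂)
open import Function using (_∘_)
open import Level using (0ℓ)
open import Relation.Binary.Bundles using (Setoid)
open import Relation.Binary.Definitions using (WeaklyDecidable)
open import Relation.Binary.PropositionalEquality
  using (_≡_; refl; sym; trans; cong; cong₂; subst; module ≡-Reasoning)
open import Relation.Nullary using (Dec; does; yes; no; contradiction)
open import Relation.Nullary.Decidable using (_×-dec_; dec-true; dec-false; dec⇒maybe)

module ℤ-Solver = Data.Integer.Solver.+-*-Solver

-- Signed sums over overpartitions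

sgn : ℕ → ℤ
sgn zero    = 1ℤ
sgn (suc n) = ℤ.- sgn n

sgn-double : ∀ n → sgn (n ℕ.+ n) ≡ 1ℤ
sgn-double zero = refl
sgn-double (suc n) rewrite ℕ.+-suc n n =
  trans (ℤ.neg-involutive (sgn (n ℕ.+ n))) (sgn-double n)

2*≡+ : ∀ i → + 2 ℤ.* i ≡ i ℤ.+ i
2*≡+ = solve 1 (λ i → con (+ 2) :* i := i :+ i) refl
  where open ℤ-Solver

0<i-j⇒j<i : ∀ {i j} → 0ℤ ℤ.< i ℤ.- j → j ℤ.< i
0<i-j⇒j<i {i} {j} 0<i-j = subst (j ℤ.<_) (i-j+j≡i i j)
  (subst (ℤ._< i ℤ.- j ℤ.+ j) (ℤ.+-identityˡ j) (ℤ.+-monoˡ-< j 0<i-j))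
  where
  open ℤ-Solver
  i-j+j≡i : ∀ i j → i ℤ.- j ℤ.+ j ≡ i
  i-j+j≡i = solve 2 (λ i j → i :- j :+ j := i) refl

i-j≡-[j-i] : ∀ i j → i ℤ.- j ≡ ℤ.- (j ℤ.- i)
i-j≡-[j-i] = solve 2 (λ i j → i :- j := :- (j :- i)) refl
  where open ℤ-Solver

-[-1*i]≡i : ∀ i → ℤ.- (-1ℤ ℤ.* i) ≡ i
-[-1*i]≡i = solve 1 (λ i → :- (con -1ℤ :* i) := i) refl
  where open ℤ-Solver

sgn-+ : ∀ m n → sgn (m ℕ.+ n) ≡ sgn m ℤ.* sgn n
sgn-+ zero    n = sym (ℤ.*-identityˡ (sgn n))
sgn-+ (suc m) n = trans (cong ℤ.-_ (sgn-+ m n)) (ℤ.neg-distribˡ-* (sgn m) (sgn n))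

sgn² : ∀ n → sgn n ℤ.* sgn n ≡ 1ℤ
sgn² n = trans (sym (sgn-+ n n)) (sgn-double n)

2∣2+n⇒2∣n : ∀ {n} → 2 ∣ 2 ℕ.+ n → 2 ∣ n
2∣2+n⇒2∣n 2∣ = ∣m+n∣m⇒∣n 2∣ ∣-refl

2∤1 : ¬ 2 ∣ 1
2∤1 (divides zero ())
2∤1 (divides (suc _) ())

2∣⇒sgn≡1 : ∀ n → 2 ∣ n → sgn n ≡ 1ℤ
2∣⇒sgn≡1 zero          _  = refl
2∣⇒sgn≡1 (suc zero)    2∣ = contradiction 2∣ 2∤1
2∣⇒sgn≡1 (suc (suc n)) 2∣ = trans (ℤ.neg-involutive (sgn n)) (2∣⇒sgn≡1 n (2∣2+n⇒2∣n 2∣))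

2∤⇒sgn≡-1 : ∀ n → ¬ 2 ∣ n → sgn n ≡ -1ℤ
2∤⇒sgn≡-1 zero          2∤ = contradiction (divides 0 refl) 2∤
2∤⇒sgn≡-1 (suc zero)    2∤ = refl
2∤⇒sgn≡-1 (suc (suc n)) 2∤ = trans (ℤ.neg-involutive (sgn n)) (2∤⇒sgn≡-1 n (2∤ ∘ ∣m∣n⇒∣m+n ∣-refl))

-- Removing a successor from both arguments keeps m - n and lowers m + n by two.
2∣∣m⊖n∣ : ∀ m n → (2 ∣ ℤ.∣ m ℤ.⊖ n ∣ → 2 ∣ m ℕ.+ n) × (2 ∣ m ℕ.+ n → 2 ∣ ℤ.∣ m ℤ.⊖ n ∣)
2∣∣m⊖n∣ zero    zero    = (λ p → p) , (λ p → p)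
2∣∣m⊖n∣ zero    (suc n) = (λ p → p) , (λ p → p)
2∣∣m⊖n∣ (suc m) zero    rewrite ℕ.+-identityʳ m = (λ p → p) , (λ p → p)
2∣∣m⊖n∣ (suc m) (suc n) rewrite ℕ.+-suc m n | ℤ.[1+m]⊖[1+n]≡m⊖n m n =
  ∣m∣n⇒∣m+n ∣-refl ∘ proj₁ (2∣∣m⊖n∣ m n) , proj₂ (2∣∣m⊖n∣ m n) ∘ 2∣2+n⇒2∣n

indicator : ∀ {P : Set} → Dec P → ℤ
indicator P? = if does P? then 1ℤ else 0ℤ

if-yes : ∀ {P : Set} (P? : Dec P) {i j : ℤ} → P → (if does P? then i else j) ≡ i
if-yes P? p = cong (if_then _ else _) (dec-true P? p)

if-no : ∀ {P : Set} (P? : Dec P) {i j : ℤ} → ¬ P → (if does P? then i else j) ≡ j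
if-no P? ¬p = cong (if_then _ else _) (dec-false P? ¬p)

-- Exactly one of m - n and m - n - 1 is even: the mixed cases yield the sign, and the other two are
-- contradictory.
parity-indicators : ∀ m n (P? : Dec (2 ∣ ℤ.∣ m ℤ.⊖ n ∣)) (R? : Dec (2 ∣ ℤ.∣ m ℤ.⊖ suc n ∣)) →
  indicator P? ℤ.- indicator R? ≡ sgn (m ℕ.+ n)
parity-indicators m n (yes p) (yes p′) = contradiction
  (∣m+n∣m⇒∣n
    (subst (2 ∣_) (trans (ℕ.+-suc m n) (ℕ.+-comm 1 (m ℕ.+ n))) (proj₁ (2∣∣m⊖n∣ m (suc n)) p′))
    (proj₁ (2∣∣m⊖n∣ m n) p)) 2∤1
parity-indicators m n (yes p) (no _)  = sym (2∣⇒sgn≡1 (m ℕ.+ n) (proj₁ (2∣∣m⊖n∣ m n) p))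
parity-indicators m n (no p) (yes _)  = sym (2∤⇒sgn≡-1 (m ℕ.+ n) (p ∘ proj₂ (2∣∣m⊖n∣ m n)))
parity-indicators m n (no p) (no p′)  = contradiction
  (trans (sym (2∤⇒sgn≡-1 _ (p′ ∘ proj₂ (2∣∣m⊖n∣ m (suc n)))))
    (trans (cong sgn (ℕ.+-suc m n)) (cong ℤ.-_ (2∤⇒sgn≡-1 _ (p ∘ proj₂ (2∣∣m⊖n∣ m n))))))
  (λ ())

-- Sums over lists

module _ {A : Set} where

  sumOver : (A → ℤ) → List A → ℤ
  sumOver f []       = 0ℤ
  sumOver f (x ∷ xs) = f x ℤ.+ sumOver f xs

  sumOver-cong : ∀ {f g : A → ℤ} → (∀ x → f x ≡ g x) → ∀ xs → sumOver f xs ≡ sumOver g xs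
  sumOver-cong f≡g []       = refl
  sumOver-cong f≡g (x ∷ xs) = cong₂ ℤ._+_ (f≡g x) (sumOver-cong f≡g xs)

  sumOver-++ : ∀ (f : A → ℤ) xs ys → sumOver f (xs ++ ys) ≡ sumOver f xs ℤ.+ sumOver f ys
  sumOver-++ f []       ys = sym (ℤ.+-identityˡ _)
  sumOver-++ f (x ∷ xs) ys = trans (cong (λ z → f x ℤ.+ z) (sumOver-++ f xs ys))
    (sym (ℤ.+-assoc (f x) _ _))

  sumOver-scale : ∀ c (f : A → ℤ) xs → sumOver (λ x → c ℤ.* f x) xs ≡ c ℤ.* sumOver f xs
  sumOver-scale c f []       = sym (ℤ.*-zeroʳ c)
  sumOver-scale c f (x ∷ xs) = trans (cong (λ z → c ℤ.* f x ℤ.+ z) (sumOver-scale c f xs))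
    (sym (ℤ.*-distribˡ-+ c (f x) _))

  sumOver-zero : ∀ (xs : List A) → sumOver (λ _ → 0ℤ) xs ≡ 0ℤ
  sumOver-zero []       = refl
  sumOver-zero (x ∷ xs) = trans (ℤ.+-identityˡ _) (sumOver-zero xs)

  sumOver-minus : ∀ (f g : A → ℤ) xs →
    sumOver f xs ℤ.- sumOver g xs ≡ sumOver (λ x → f x ℤ.- g x) xs
  sumOver-minus f g []       = refl
  sumOver-minus f g (x ∷ xs) = trans
    (solve 4 (λ a b s t → a :+ s :- (b :+ t) := a :- b :+ (s :- t)) refl
      (f x) (g x) (sumOver f xs) (sumOver g xs))
    (cong (λ z → f x ℤ.- g x ℤ.+ z) (sumOver-minus f g xs))
    where open ℤ-Solver

  length-filter≡sumOver : ∀ {P : A → Set} (P? : ∀ x → Dec (P x)) xs →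
    + length (filter P? xs) ≡ sumOver (indicator ∘ P?) xs
  length-filter≡sumOver P? []       = refl
  length-filter≡sumOver P? (x ∷ xs) with does (P? x)
  ... | false = trans (length-filter≡sumOver P? xs) (sym (ℤ.+-identityˡ _))
  ... | true  = cong (λ z → 1ℤ ℤ.+ z) (length-filter≡sumOver P? xs)

  sumOver-filter : ∀ {P : A → Set} (P? : ∀ x → Dec (P x)) (f : A → ℤ) xs →
    sumOver f (filter P? xs) ≡ sumOver (λ x → if does (P? x) then f x else 0ℤ) xs
  sumOver-filter P? f []       = refl
  sumOver-filter P? f (x ∷ xs) with does (P? x)
  ... | false = trans (sumOver-filter P? f xs) (sym (ℤ.+-identityˡ _))
  ... | true  = cong (λ z → f x ℤ.+ z) (sumOver-filter P? f xs)

sumOver-map : ∀ {A B : Set} (f : B → ℤ) (h : A → B) xs → sumOver f (map h xs) ≡ sumOver (f ∘ h) xs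
sumOver-map f h []       = refl
sumOver-map f h (x ∷ xs) = cong (λ z → f (h x) ℤ.+ z) (sumOver-map f h xs)

sumOver-product : ∀ {A B C : Set} (f : C → ℤ) (h : A → B → C) xs ys →
  sumOver f (cartesianProductWith h xs ys) ≡ sumOver (λ x → sumOver (λ y → f (h x y)) ys) xs
sumOver-product f h []       ys = refl
sumOver-product f h (x ∷ xs) ys = trans (sumOver-++ f (map (h x) ys) _)
  (cong₂ ℤ._+_ (sumOver-map f (h x) ys) (sumOver-product f h xs ys))

sumOver-upTo-suc : ∀ (f : ℕ → ℤ) n → sumOver f (upTo (suc n)) ≡ sumOver f (upTo n) ℤ.+ f n
sumOver-upTo-suc f n = trans (cong (sumOver f) (sym (upTo-∷ʳ n)))
  (trans (sumOver-++ f (upTo n) (n ∷ []))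
    (cong (λ z → sumOver f (upTo n) ℤ.+ z) (ℤ.+-identityʳ (f n))))

-- Rank parity as a product of signs of parts

weight : List Part → ℤ
weight []       = 1ℤ
weight (x ∷ xs) = sgn (suc (size x)) ℤ.* weight xs

weight≡sgn : ∀ xs → weight xs ≡ sgn (sum (map size xs) ℕ.+ length xs)
weight≡sgn []       = refl
weight≡sgn (x ∷ xs) = trans (cong (sgn (suc (size x)) ℤ.*_) (weight≡sgn xs))
  (trans (sym (sgn-+ (suc (size x)) _))
    (cong sgn (trans
      (sym (cong suc (ℕ.+-assoc (size x) (sum (map size xs)) (length xs))))
      (sym (ℕ.+-suc _ (length xs))))))

sizes≤head : ∀ {p} ps → Linked _≽_ (p ∷ ps) → All (_≤ size p) (map size ps)
sizes≤head []       [-]       = []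
sizes≤head (x ∷ ps) (p≽x ∷ l) =
  proj₁ p≽x ∷ All.map (λ y≤x → ℕ.≤-trans y≤x (proj₁ p≽x)) (sizes≤head ps l)

rank-parity : ∀ ps →
  indicator (rank ps ≡? + 0 [mod 2 ]) ℤ.- indicator (rank ps ≡? + 1 [mod 2 ]) ≡
  sgn (largestPart ps ℕ.+ length ps)
rank-parity ps = trans
  (cong₂ (λ i j → indicator (2 ∣? ℤ.∣ i ∣) ℤ.- indicator (2 ∣? ℤ.∣ j ∣)) rank-0 rank-1)
  (parity-indicators (largestPart ps) (length ps) (2 ∣? _) (2 ∣? _))
  where
  ℓ = largestPart ps
  k = length ps
  rank-0 : rank ps ℤ.- + 0 ≡ ℓ ℤ.⊖ k
  rank-0 = trans (ℤ.+-identityʳ (rank ps)) (ℤ.m-n≡m⊖n ℓ k)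
  rank-1 : rank ps ℤ.- + 1 ≡ ℓ ℤ.⊖ suc k
  rank-1 = trans (ℤ.+-assoc (+ ℓ) (ℤ.- + k) -1ℤ)
    (trans (cong (λ z → + ℓ ℤ.+ z)
        (trans (ℤ.+-comm (ℤ.- + k) -1ℤ) (sym (ℤ.neg-distrib-+ 1ℤ (+ k)))))
      (ℤ.m-n≡m⊖n ℓ (suc k)))

rank-sign : ∀ {n} x xs → IsOverpartition n (x ∷ xs) →
  indicator (rank (x ∷ xs) ≡? + 0 [mod 2 ]) ℤ.- indicator (rank (x ∷ xs) ≡? + 1 [mod 2 ]) ≡
  ℤ.- sgn n ℤ.* weight xs
rank-sign x xs (isOverpartition _ l refl) = begin
  _                                              ≡⟨ rank-parity (x ∷ xs) ⟩
  sgn (largestPart (x ∷ xs) ℕ.+ suc k)           ≡⟨ cong (λ m → sgn (m ℕ.+ suc k)) largest ⟩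
  sgn (a ℕ.+ suc k)                              ≡⟨ sgn-+ a (suc k) ⟩
  sgn a ℤ.* (ℤ.- sgn k)                          ≡⟨ cong (λ z → sgn a ℤ.* (ℤ.- z)) (ℤ.*-identityˡ (sgn k)) ⟨
  -- The sign of the sum s of the remaining parts is inserted twice: one copy completes `sgn a` to
  -- the sign of n = a + s, the other completes `sgn k` to the weight of the remaining parts.
  sgn a ℤ.* (ℤ.- (1ℤ ℤ.* sgn k))                 ≡⟨ cong (λ z → sgn a ℤ.* (ℤ.- (z ℤ.* sgn k))) (sgn² s) ⟨
  sgn a ℤ.* (ℤ.- (sgn s ℤ.* sgn s ℤ.* sgn k))    ≡⟨ regroup (sgn a) (sgn s) (sgn k) ⟩
  ℤ.- (sgn a ℤ.* sgn s) ℤ.* (sgn s ℤ.* sgn k)    ≡⟨ cong₂ (λ i j → ℤ.- i ℤ.* j) (sgn-+ a s) (sgn-+ s k) ⟨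
  ℤ.- sgn (a ℕ.+ s) ℤ.* sgn (s ℕ.+ k)            ≡⟨ cong (ℤ.- sgn (a ℕ.+ s) ℤ.*_) (weight≡sgn xs) ⟨
  ℤ.- sgn (a ℕ.+ s) ℤ.* weight xs                ∎
  where
  open ≡-Reasoning
  a = size x
  s = sum (map size xs)
  k = length xs
  largest : largestPart (x ∷ xs) ≡ a
  largest = max≈v⁺ (here refl) (ℕ.≤-refl ∷ sizes≤head xs l) z≤n
  regroup : ∀ a s k → a ℤ.* (ℤ.- (s ℤ.* s ℤ.* k)) ≡ ℤ.- (a ℤ.* s) ℤ.* (s ℤ.* k)
  regroup = solve 3 (λ a s k → a :* (:- (s :* s :* k)) := (:- (a :* s)) :* (s :* k)) refl
    where open ℤ-Solver

IsTail : Part → ℕ → List Part → Set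
IsTail p n xs = All (λ x → 1 ≤ size x) xs × Linked _≽_ (p ∷ xs) × sum (map size xs) ≡ n

fits? : ∀ n x → Dec (1 ≤ size x × size x ≤ n)
fits? n x = (1 ≤? size x) ×-dec (size x ≤? n)

-- The weight of the list if it continues an overpartition after p and has sum n, and 0
-- otherwise; headedWeight leaves out the sign of the head, which is the largest part.
tailWeight : Part → ℕ → List Part → ℤ
tailWeight p zero    []       = 1ℤ
tailWeight p (suc n) []       = 0ℤ
tailWeight p n       (x ∷ xs) =
  if does (fits? n x ×-dec (p ≽? x))
  then sgn (suc (size x)) ℤ.* tailWeight x (n ∸ size x) xs else 0ℤ

headedWeight : ℕ → List Part → ℤ
headedWeight n []       = 0ℤ
headedWeight n (x ∷ xs) = if does (fits? n x) then tailWeight x (n ∸ size x) xs else 0ℤ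

tailWeight-∷-yes : ∀ {n x} p xs → (1 ≤ size x × size x ≤ n) × p ≽ x →
  tailWeight p n (x ∷ xs) ≡ sgn (suc (size x)) ℤ.* tailWeight x (n ∸ size x) xs
tailWeight-∷-yes {zero}  {x} p xs = if-yes (fits? zero x ×-dec (p ≽? x))
tailWeight-∷-yes {suc n} {x} p xs = if-yes (fits? (suc n) x ×-dec (p ≽? x))

tailWeight-∷-no : ∀ {n x} p xs → ¬ ((1 ≤ size x × size x ≤ n) × p ≽ x) →
  tailWeight p n (x ∷ xs) ≡ 0ℤ
tailWeight-∷-no {zero}  {x} p xs = if-no (fits? zero x ×-dec (p ≽? x))
tailWeight-∷-no {suc n} {x} p xs = if-no (fits? (suc n) x ×-dec (p ≽? x))

tailWeight-IsTail : ∀ p n xs → IsTail p n xs → tailWeight p n xs ≡ weight xs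
tailWeight-IsTail p n []       (_ , _ , refl) = refl
tailWeight-IsTail p n (x ∷ xs) (pos ∷ poss , p≽x ∷ l , refl) = trans
  (tailWeight-∷-yes p xs ((pos , ℕ.m≤m+n (size x) _) , p≽x))
  (cong (sgn (suc (size x)) ℤ.*_) (tailWeight-IsTail x _ xs
    (poss , l , sym (ℕ.m+n∸m≡n (size x) (sum (map size xs))))))

-- This dichotomy discards the candidates that are not overpartitions: if the head fits, the failure
-- lies in the tail, whose weight is then 0.
tailWeight-support : ∀ p n xs → IsTail p n xs ⊎ tailWeight p n xs ≡ 0ℤ
tailWeight-support p zero    [] = inj₁ ([] , [-] , refl)
tailWeight-support p (suc n) [] = inj₂ refl
tailWeight-support p n (x ∷ xs) with fits? n x ×-dec (p ≽? x) | tailWeight-support x (n ∸ size x) xs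
... | no ¬ok | _ = inj₂ (tailWeight-∷-no p xs ¬ok)
... | yes ((pos , x≤n) , p≽x) | inj₁ (poss , l , s) =
  inj₁ (pos ∷ poss , p≽x ∷ l , trans (cong (size x ℕ.+_) s) (ℕ.m+[n∸m]≡n x≤n))
... | yes ok | inj₂ ≡0 = inj₂ (trans (tailWeight-∷-yes p xs ok)
  (trans (cong (sgn (suc (size x)) ℤ.*_) ≡0) (ℤ.*-zeroʳ (sgn (suc (size x))))))

rank-term : ∀ n ps → n ≥ 1 →
  (if does (isOverpartition? n ps)
   then indicator (rank ps ≡? + 0 [mod 2 ]) ℤ.- indicator (rank ps ≡? + 1 [mod 2 ]) else 0ℤ) ≡
  ℤ.- sgn n ℤ.* headedWeight n ps
rank-term (suc n) [] _ = sym (ℤ.*-zeroʳ (ℤ.- sgn (suc n)))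
rank-term n (x ∷ xs) _ = by-cases (isOverpartition? n (x ∷ xs)) (fits? n x)
    (tailWeight-support x (n ∸ size x) xs)
  where
  by-cases : (O? : Dec (IsOverpartition n (x ∷ xs))) (F? : Dec (1 ≤ size x × size x ≤ n)) →
    IsTail x (n ∸ size x) xs ⊎ tailWeight x (n ∸ size x) xs ≡ 0ℤ →
    (if does O?
     then indicator (rank (x ∷ xs) ≡? + 0 [mod 2 ]) ℤ.- indicator (rank (x ∷ xs) ≡? + 1 [mod 2 ])
     else 0ℤ) ≡
    ℤ.- sgn n ℤ.* (if does F? then tailWeight x (n ∸ size x) xs else 0ℤ)
  by-cases (yes o@(isOverpartition (pos ∷ poss) l refl)) F? _ = trans (rank-sign x xs o)
    (cong (ℤ.- sgn n ℤ.*_) (sym (trans (if-yes F? (pos , ℕ.m≤m+n (size x) _))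
      (tailWeight-IsTail x _ xs (poss , l , sym (ℕ.m+n∸m≡n (size x) (sum (map size xs))))))))
  by-cases (no ¬o) (no _) _ = sym (ℤ.*-zeroʳ (ℤ.- sgn n))
  by-cases (no ¬o) (yes (pos , x≤n)) (inj₁ (poss , l , s)) = contradiction
    (isOverpartition (pos ∷ poss) l (trans (cong (size x ℕ.+_) s) (ℕ.m+[n∸m]≡n x≤n))) ¬o
  by-cases (no ¬o) (yes _) (inj₂ ≡0) =
    sym (trans (cong (ℤ.- sgn n ℤ.*_) ≡0) (ℤ.*-zeroʳ (ℤ.- sgn n)))

-- The filters become zero summands, so that the sum runs over all candidates and can follow the
-- recursion of `listsUpTo`.
N̄-difference : ∀ n → n ≥ 1 →
  + N̄ 0 2 n ℤ.- + N̄ 1 2 n ≡ ℤ.- sgn n ℤ.* sumOver (headedWeight n) (listsUpTo n (partsUpTo n))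
N̄-difference n n≥1 = begin
  + N̄ 0 2 n ℤ.- + N̄ 1 2 n
    ≡⟨ cong₂ ℤ._-_ (length-filter≡sumOver even? (overpartitions n))
        (length-filter≡sumOver odd? (overpartitions n)) ⟩
  sumOver (indicator ∘ even?) (overpartitions n) ℤ.- sumOver (indicator ∘ odd?) (overpartitions n)
    ≡⟨ sumOver-minus (indicator ∘ even?) (indicator ∘ odd?) (overpartitions n) ⟩
  sumOver (λ ps → indicator (even? ps) ℤ.- indicator (odd? ps)) (overpartitions n)
    ≡⟨ sumOver-filter (isOverpartition? n) _ candidates ⟩
  sumOver (λ ps → if does (isOverpartition? n ps)
    then indicator (even? ps) ℤ.- indicator (odd? ps) else 0ℤ) candidates
    ≡⟨ sumOver-cong (λ ps → rank-term n ps n≥1) candidates ⟩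
  sumOver (λ ps → ℤ.- sgn n ℤ.* headedWeight n ps) candidates
    ≡⟨ sumOver-scale (ℤ.- sgn n) (headedWeight n) candidates ⟩
  ℤ.- sgn n ℤ.* sumOver (headedWeight n) candidates
    ∎
  where
  open ≡-Reasoning
  candidates = listsUpTo n (partsUpTo n)
  even? : ∀ ps → Dec (rank ps ≡ + 0 [mod 2 ])
  even? ps = rank ps ≡? + 0 [mod 2 ]
  odd? : ∀ ps → Dec (rank ps ≡ + 1 [mod 2 ])
  odd? ps = rank ps ≡? + 1 [mod 2 ]

listsUpTo-suc-sum : ∀ (f : List Part → ℤ) k N →
  sumOver f (listsUpTo (suc k) (partsUpTo N)) ≡
  f [] ℤ.+ sumOver (λ j → sumOver (λ xs → f ((j , false) ∷ xs)) (listsUpTo k (partsUpTo N)) ℤ.+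
                          sumOver (λ xs → f ((j , true) ∷ xs)) (listsUpTo k (partsUpTo N)))
             (upTo (suc N))
listsUpTo-suc-sum f k N = cong (λ z → f [] ℤ.+ z)
  (trans (sumOver-product f _∷_ (partsUpTo N) lists)
    (trans (sumOver-product headed _,_ (upTo (suc N)) (false ∷ true ∷ []))
      (sumOver-cong (λ j → cong (λ z → headed (j , false) ℤ.+ z) (ℤ.+-identityʳ _)) (upTo (suc N)))))
  where
  lists = listsUpTo k (partsUpTo N)
  headed : Part → ℤ
  headed x = sumOver (λ xs → f (x ∷ xs)) lists

sumOver-all-zero : ∀ {A : Set} {f : A → ℤ} → (∀ x → f x ≡ 0ℤ) → ∀ xs → sumOver f xs ≡ 0ℤ
sumOver-all-zero f≡0 xs = trans (sumOver-cong f≡0 xs) (sumOver-zero xs)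

-- Formal power series over ℤ

Series : Set
Series = ℕ → ℤ

infix 4 _≈_
-- A record rather than a bare pointwise equality, so that f and g can be inferred from a proof.
record _≈_ (f g : Series) : Set where
  constructor pointwise
  field at : ∀ n → f n ≡ g n
open _≈_

module Convolution where
  open import Data.Integer using (_+_; _*_)
  open ℤ-Solver

  conv : Series → Series → Series
  conv f g zero    = f 0 * g 0
  conv f g (suc n) = f 0 * g (suc n) + conv (f ∘ suc) g n

  conv-cong : ∀ {f f′ g g′} → (∀ n → f n ≡ f′ n) → (∀ n → g n ≡ g′ n) →
              ∀ n → conv f g n ≡ conv f′ g′ n
  conv-cong p r zero    = cong₂ _*_ (p 0) (r 0)
  conv-cong p r (suc n) =
    cong₂ _+_ (cong₂ _*_ (p 0) (r (suc n))) (conv-cong (p ∘ suc) r n)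

  conv-distribʳ : ∀ f g h n → conv (λ k → f k + g k) h n ≡ conv f h n + conv g h n
  conv-distribʳ f g h zero    = ℤ.*-distribʳ-+ (h 0) (f 0) (g 0)
  conv-distribʳ f g h (suc n) =
    trans (cong (λ z → (f 0 + g 0) * h (suc n) + z) (conv-distribʳ (f ∘ suc) (g ∘ suc) h n))
      (solve 5 (λ a b c x y → (a :+ b) :* c :+ (x :+ y) := a :* c :+ x :+ (b :* c :+ y)) refl
        (f 0) (g 0) (h (suc n)) (conv (f ∘ suc) h n) (conv (g ∘ suc) h n))

  conv-scale : ∀ c f h n → conv (λ k → c * f k) h n ≡ c * conv f h n
  conv-scale c f h zero    = ℤ.*-assoc c (f 0) (h 0)
  conv-scale c f h (suc n) =
    trans (cong (λ z → c * f 0 * h (suc n) + z) (conv-scale c (f ∘ suc) h n))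
      (solve 4 (λ c a b x → c :* a :* b :+ c :* x := c :* (a :* b :+ x)) refl
        c (f 0) (h (suc n)) (conv (f ∘ suc) h n))

  conv-zeroˡ : ∀ g n → conv (λ _ → 0ℤ) g n ≡ 0ℤ
  conv-zeroˡ g zero    = refl
  conv-zeroˡ g (suc n) = trans (ℤ.+-identityˡ _) (conv-zeroˡ g n)

  -- The mirror image of the defining recursion, splitting off g 0 in place of f 0; commutativity
  -- rests on it.
  conv-sucʳ : ∀ f g n → conv f g (suc n) ≡ f (suc n) * g 0 + conv f (g ∘ suc) n
  conv-sucʳ f g zero    = ℤ.+-comm (f 0 * g 1) (f 1 * g 0)
  conv-sucʳ f g (suc n) =
    trans (cong (λ z → f 0 * g (2 ℕ.+ n) + z) (conv-sucʳ (f ∘ suc) g n))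
      (solve 3 (λ a b c → a :+ (b :+ c) := b :+ (a :+ c)) refl
        (f 0 * g (2 ℕ.+ n)) (f (2 ℕ.+ n) * g 0) (conv (f ∘ suc) (g ∘ suc) n))

  conv-comm : ∀ f g n → conv f g n ≡ conv g f n
  conv-comm f g zero    = ℤ.*-comm (f 0) (g 0)
  conv-comm f g (suc n) =
    trans (cong₂ _+_ (ℤ.*-comm (f 0) (g (suc n))) (conv-comm (f ∘ suc) g n))
      (sym (conv-sucʳ g f n))

  -- The shift of `conv f g` is f 0 times the shift of g plus the convolution of the shift of f with
  -- g, so distributivity and scaling reduce the claim to the induction hypothesis.
  conv-assoc : ∀ f g h n → conv (conv f g) h n ≡ conv f (conv g h) n
  conv-assoc f g h zero    = ℤ.*-assoc (f 0) (g 0) (h 0)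
  conv-assoc f g h (suc n) =
    trans (cong (λ z → f 0 * g 0 * h (suc n) + z)
      (trans (conv-distribʳ (λ k → f 0 * g (suc k)) (conv (f ∘ suc) g) h n)
        (cong₂ _+_ (conv-scale (f 0) (g ∘ suc) h n) (conv-assoc (f ∘ suc) g h n))))
      (solve 5 (λ a b c x y → a :* b :* c :+ (a :* x :+ y) := a :* (b :* c :+ x) :+ y) refl
        (f 0) (g 0) (h (suc n)) (conv (g ∘ suc) h n) (conv (f ∘ suc) (conv g h) n))

open Convolution

infixl 6 _+_
infixl 7 _*_
infix  8 -_

const : ℤ → Series
const c zero    = c
const c (suc n) = 0ℤ

0# 1# 2# : Series
0# = const 0ℤ
1# = const 1ℤ
2# = const (+ 2)

-- Opaque, so that ring identities are settled symbolically and convolutions stay folded.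
opaque
  _+_ _*_ : Series → Series → Series
  (f + g) n = f n ℤ.+ g n
  _*_ = conv

  -_ : Series → Series
  (- f) n = ℤ.- f n

  coeff-+ : ∀ f g n → (f + g) n ≡ f n ℤ.+ g n
  coeff-+ f g n = refl

  const-+ : ∀ a b → const (a ℤ.+ b) ≈ const a + const b
  at (const-+ a b) zero    = refl
  at (const-+ a b) (suc n) = refl

  const-neg : ∀ a → const (ℤ.- a) ≈ - const a
  at (const-neg a) zero    = refl
  at (const-neg a) (suc n) = refl

  const-* : ∀ a b → const (a ℤ.* b) ≈ const a * const b
  at (const-* a b) zero    = refl
  at (const-* a b) (suc n) = sym
    (cong₂ ℤ._+_ (ℤ.*-zeroʳ a) (conv-zeroˡ (const b) n))

  +-cong : ∀ {f f′ g g′} → f ≈ f′ → g ≈ g′ → f + g ≈ f′ + g′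
  at (+-cong p r) n = cong₂ ℤ._+_ (at p n) (at r n)

  *-cong : ∀ {f f′ g g′} → f ≈ f′ → g ≈ g′ → f * g ≈ f′ * g′
  at (*-cong p r) = conv-cong (at p) (at r)

  -‿cong : ∀ {f g} → f ≈ g → - f ≈ - g
  at (-‿cong p) n = cong ℤ.-_ (at p n)

  +-assoc : ∀ f g h → (f + g) + h ≈ f + (g + h)
  at (+-assoc f g h) n = ℤ.+-assoc (f n) (g n) (h n)

  +-comm : ∀ f g → f + g ≈ g + f
  at (+-comm f g) n = ℤ.+-comm (f n) (g n)

  +-identityˡ : ∀ f → 0# + f ≈ f
  at (+-identityˡ f) zero    = ℤ.+-identityˡ (f 0)
  at (+-identityˡ f) (suc n) = ℤ.+-identityˡ (f (suc n))

  -‿inverseˡ : ∀ f → - f + f ≈ 0#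
  at (-‿inverseˡ f) zero    = ℤ.+-inverseˡ (f 0)
  at (-‿inverseˡ f) (suc n) = ℤ.+-inverseˡ (f (suc n))

  *-assoc : ∀ f g h → (f * g) * h ≈ f * (g * h)
  at (*-assoc f g h) = conv-assoc f g h

  *-comm : ∀ f g → f * g ≈ g * f
  at (*-comm f g) = conv-comm f g

  *-identityˡ : ∀ f → 1# * f ≈ f
  at (*-identityˡ f) zero    = ℤ.*-identityˡ (f 0)
  at (*-identityˡ f) (suc n) =
    trans (cong₂ ℤ._+_ (ℤ.*-identityˡ (f (suc n))) (conv-zeroˡ f n)) (ℤ.+-identityʳ (f (suc n)))

  *-distribʳ-+ : ∀ h f g → (f + g) * h ≈ f * h + g * h
  at (*-distribʳ-+ h f g) = conv-distribʳ f g h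

≈-refl : ∀ {f} → f ≈ f
at ≈-refl n = refl

≈-sym : ∀ {f g} → f ≈ g → g ≈ f
at (≈-sym p) n = sym (at p n)

≈-trans : ∀ {f g h} → f ≈ g → g ≈ h → f ≈ h
at (≈-trans p r) n = trans (at p n) (at r n)

seriesSetoid : Setoid 0ℓ 0ℓ
seriesSetoid = record
  { Carrier = Series ; _≈_ = _≈_
  ; isEquivalence = record { refl = ≈-refl ; sym = ≈-sym ; trans = ≈-trans } }

seriesRing : CommutativeRing 0ℓ 0ℓ
seriesRing = record
  { Carrier = Series ; _≈_ = _≈_ ; _+_ = _+_ ; _*_ = _*_ ; -_ = -_ ; 0# = 0# ; 1# = 1#
  ; isCommutativeRing = record
    { isRing = record
      { +-isAbelianGroup = record
        { isGroup = record
          { isMonoid = record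
            { isSemigroup = record
              { isMagma = record
                { isEquivalence = Setoid.isEquivalence seriesSetoid
                ; ∙-cong = +-cong
                }
              ; assoc = +-assoc
              }
            ; identity = comm∧idˡ⇒id +-comm +-identityˡ
            }
          ; inverse = comm∧invˡ⇒inv +-comm -‿inverseˡ
          ; ⁻¹-cong = -‿cong
          }
        ; comm = +-comm
        }
      ; *-cong = *-cong
      ; *-assoc = *-assoc
      ; *-identity = comm∧idˡ⇒id *-comm *-identityˡ
      ; distrib = comm∧distrʳ⇒distr +-cong *-comm *-distribʳ-+
      }
    ; *-comm = *-comm
    }
  }
  where
  open import Algebra.Consequences.Setoid seriesSetoid

open CommutativeRing seriesRing
  using (_-_; zeroˡ; zeroʳ; +-congˡ; +-congʳ; *-congˡ; *-congʳ; reflexive)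

seriesAlmostCommutativeRing : ACR.AlmostCommutativeRing 0ℓ 0ℓ
seriesAlmostCommutativeRing = ACR.fromCommutativeRing seriesRing

const-homomorphism : ℤ.+-*-rawRing ACR.-Raw-AlmostCommutative⟶ seriesAlmostCommutativeRing
const-homomorphism = record
  { ⟦_⟧ = const ; +-homo = const-+ ; *-homo = const-*
  ; -‿homo = const-neg ; 0-homo = ≈-refl ; 1-homo = ≈-refl }

const≟ : WeaklyDecidable (ACR.Induced-equivalence const-homomorphism)
const≟ a b = Maybe.map (λ { refl → ≈-refl }) (dec⇒maybe (a ℤ.≟ b))

open Algebra.Solver.Ring ℤ.+-*-rawRing seriesAlmostCommutativeRing const-homomorphism const≟
  using (Polynomial; solve; con; _:+_; _:*_; _:-_; :-_; _:=_)

private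
  variable
    a a′ b b′ c d f g h x y : Series

  :0 :1 :2 : ∀ {n} → Polynomial n
  :0 = con 0ℤ
  :1 = con 1ℤ
  :2 = con (+ 2)

-- Finite sums and consequences of ring equations

∑ : (ℕ → Series) → ℕ → Series
∑ f zero    = 0#
∑ f (suc n) = ∑ f n + f n

∑-distribˡ : ∀ c f n → c * ∑ f n ≈ ∑ (λ i → c * f i) n
∑-distribˡ c f zero    = zeroʳ c
∑-distribˡ c f (suc n) = ≈-trans
  (solve 3 (λ c x y → c :* (x :+ y) := c :* x :+ c :* y) ≈-refl c (∑ f n) (f n))
  (+-congʳ (∑-distribˡ c f n))

x-y≈0⇒x≈y : x - y ≈ 0# → x ≈ y
x-y≈0⇒x≈y {x} {y} eq = ≈-trans
  (solve 2 (λ x y → x := y :+ (x :- y)) ≈-refl x y)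
  (≈-trans (+-congˡ eq) (solve 1 (λ y → y :+ :0 := y) ≈-refl y))

x≈y⇒c[x-y]≈0 : ∀ c → x ≈ y → c * (x - y) ≈ 0#
x≈y⇒c[x-y]≈0 {y = y} c x≈y = ≈-trans (*-congˡ (+-congʳ x≈y))
  (solve 2 (λ c y → c :* (y :- y) := :0) ≈-refl c y)

-- Ideal membership: an equation follows from others once the difference of
-- its sides is a combination of theirs, which the ring solver can check.
combine₁ : a ≈ b → x - y ≈ c * (a - b) → x ≈ y
combine₁ {c = c} p eq = x-y≈0⇒x≈y (≈-trans eq (x≈y⇒c[x-y]≈0 c p))

combine₂ : a ≈ b → a′ ≈ b′ → x - y ≈ c * (a - b) + d * (a′ - b′) → x ≈ y
combine₂ {c = c} {d = d} p p′ eq = x-y≈0⇒x≈y (≈-trans eq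
  (≈-trans (+-cong (x≈y⇒c[x-y]≈0 c p) (x≈y⇒c[x-y]≈0 d p′))
    (solve 0 (:0 :+ :0 := :0) ≈-refl)))

combine₃ : a ≈ b → a′ ≈ b′ → f ≈ g →
  x - y ≈ c * (a - b) + d * (a′ - b′) + h * (f - g) → x ≈ y
combine₃ {c = c} {d = d} {h = h} p p′ p″ eq = x-y≈0⇒x≈y (≈-trans eq
  (≈-trans (+-cong (+-cong (x≈y⇒c[x-y]≈0 c p) (x≈y⇒c[x-y]≈0 d p′)) (x≈y⇒c[x-y]≈0 h p″))
    (solve 0 (:0 :+ :0 :+ :0 := :0) ≈-refl)))

combine₄ : ∀ {a₁ b₁ a₂ b₂ a₃ b₃ a₄ b₄ c₁ c₂ c₃ c₄} →
  a₁ ≈ b₁ → a₂ ≈ b₂ → a₃ ≈ b₃ → a₄ ≈ b₄ →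
  x - y ≈ c₁ * (a₁ - b₁) + c₂ * (a₂ - b₂) + c₃ * (a₃ - b₃) + c₄ * (a₄ - b₄) → x ≈ y
combine₄ {c₁ = c₁} {c₂} {c₃} {c₄} p₁ p₂ p₃ p₄ eq = x-y≈0⇒x≈y (≈-trans eq (≈-trans
  (+-cong (+-cong (+-cong (x≈y⇒c[x-y]≈0 c₁ p₁) (x≈y⇒c[x-y]≈0 c₂ p₂)) (x≈y⇒c[x-y]≈0 c₃ p₃))
    (x≈y⇒c[x-y]≈0 c₄ p₄))
  (solve 0 (:0 :+ :0 :+ :0 :+ :0 := :0) ≈-refl)))

combine₅ : ∀ {a₁ b₁ a₂ b₂ a₃ b₃ a₄ b₄ a₅ b₅ c₁ c₂ c₃ c₄ c₅} →
  a₁ ≈ b₁ → a₂ ≈ b₂ → a₃ ≈ b₃ → a₄ ≈ b₄ → a₅ ≈ b₅ →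
  x - y ≈ c₁ * (a₁ - b₁) + c₂ * (a₂ - b₂) + c₃ * (a₃ - b₃) + c₄ * (a₄ - b₄) + c₅ * (a₅ - b₅) →
  x ≈ y
combine₅ {c₁ = c₁} {c₂} {c₃} {c₄} {c₅} p₁ p₂ p₃ p₄ p₅ eq = x-y≈0⇒x≈y (≈-trans eq (≈-trans
  (+-cong (+-cong (+-cong (+-cong (x≈y⇒c[x-y]≈0 c₁ p₁) (x≈y⇒c[x-y]≈0 c₂ p₂))
    (x≈y⇒c[x-y]≈0 c₃ p₃)) (x≈y⇒c[x-y]≈0 c₄ p₄)) (x≈y⇒c[x-y]≈0 c₅ p₅))
  (solve 0 (:0 :+ :0 :+ :0 :+ :0 :+ :0 := :0) ≈-refl)))

Unit : Series → Set
Unit u = ∃[ v ] u * v ≈ 1#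

cancel : Unit c → c * x ≈ c * y → x ≈ y
cancel {c} {x} {y} (v , cv≈1) eq = combine₂ cv≈1 eq
  (solve 4 (λ c v x y → x :- y := (y :- x) :* (c :* v :- :1) :+ v :* (c :* x :- c :* y))
    ≈-refl c v x y)

-- Powers of q and coefficient extraction

q : Series
q (suc zero) = 1ℤ
q _          = 0ℤ

infix 9 q^_
q^_ : ℕ → Series
q^ zero  = 1#
q^ suc k = q * q^ k

-- The k-th power of Q = q². `Q (suc k)` unfolds to two factors q, which lets polynomial identities
-- in q and `Q k` speak of `Q (suc k)`.
Q : ℕ → Series
Q zero    = 1#
Q (suc k) = q * (q * Q k)

-- sq k = q^(k²).
sq : ℕ → Series
sq zero    = 1#
sq (suc k) = sq k * Q k * q

opaque
  unfolding _+_

  coeff-q*-zero : ∀ f → (q * f) 0 ≡ 0ℤ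
  coeff-q*-zero f = refl

  coeff-q*-suc : ∀ f n → (q * f) (suc n) ≡ f n
  coeff-q*-suc f n = trans (ℤ.+-identityˡ _)
    (trans (at (*-cong q∘suc≈1 ≈-refl) n) (at (*-identityˡ f) n))
    where
    q∘suc≈1 : q ∘ suc ≈ 1#
    at q∘suc≈1 zero    = refl
    at q∘suc≈1 (suc n) = refl

  coeff-const*  : ∀ c f n → (const c * f) n ≡ c ℤ.* f n
  coeff-const* c f zero    = refl
  coeff-const* c f (suc n) =
    trans (cong (λ z → c ℤ.* f (suc n) ℤ.+ z) (Convolution.conv-zeroˡ f n)) (ℤ.+-identityʳ _)

coeff-q^*-< : ∀ {k n} f → n < k → (q^ k * f) n ≡ 0ℤ
coeff-q^*-< {suc k} {zero} f _ = trans (at (*-assoc q (q^ k) f) 0) (coeff-q*-zero (q^ k * f))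
coeff-q^*-< {suc k} {suc n} f (s≤s n<k) =
  trans (at (*-assoc q (q^ k) f) (suc n)) (trans (coeff-q*-suc (q^ k * f) n) (coeff-q^*-< f n<k))

coeff-q^*-+ : ∀ k n f → (q^ k * f) (k ℕ.+ n) ≡ f n
coeff-q^*-+ zero n f = at (*-identityˡ f) n
coeff-q^*-+ (suc k) n f = trans (at (*-assoc q (q^ k) f) (suc (k ℕ.+ n)))
  (trans (coeff-q*-suc (q^ k * f) (k ℕ.+ n)) (coeff-q^*-+ k n f))

Q-+ : ∀ m n → Q (m ℕ.+ n) ≈ Q m * Q n
Q-+ zero n = ≈-sym (*-identityˡ (Q n))
Q-+ (suc m) n = combine₁ (Q-+ m n)
  (solve 4 (λ q x y z → q :* (q :* z) :- q :* (q :* x) :* y := q :* q :* (z :- x :* y))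
    ≈-refl q (Q m) (Q n) (Q (m ℕ.+ n)))

q^[k+k]≈Q : ∀ k → q^ (k ℕ.+ k) ≈ Q k
q^[k+k]≈Q zero = ≈-refl
q^[k+k]≈Q (suc k) rewrite ℕ.+-suc k k = *-congˡ (*-congˡ (q^[k+k]≈Q k))

-- Geometric series and units

-- The series q^j / (1 − s q^(k+1)).
geometricShift : ℤ → ℕ → ℕ → Series
geometricShift s k zero    zero    = 1ℤ
geometricShift s k zero    (suc n) = s ℤ.* geometricShift s k k n
geometricShift s k (suc j) zero    = 0ℤ
geometricShift s k (suc j) (suc n) = geometricShift s k j n

geometric : ℤ → ℕ → Series
geometric s k = geometricShift s k 0

geometricShift≈q^* : ∀ s k j → geometricShift s k j ≈ q^ j * geometric s k
geometricShift≈q^* s k zero = ≈-sym (*-identityˡ _)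
geometricShift≈q^* s k (suc j) = ≈-trans shift
  (≈-trans (*-congˡ (geometricShift≈q^* s k j)) (≈-sym (*-assoc q (q^ j) _)))
  where
  shift : geometricShift s k (suc j) ≈ q * geometricShift s k j
  at shift zero    = sym (coeff-q*-zero (geometricShift s k j))
  at shift (suc n) = sym (coeff-q*-suc (geometricShift s k j) n)

geometric-unfold : ∀ s k → geometric s k ≈ 1# + const s * (q^ suc k * geometric s k)
geometric-unfold s k = ≈-trans unfold′ (+-congˡ (*-congˡ
  (≈-trans (*-congˡ (geometricShift≈q^* s k k)) (≈-sym (*-assoc q (q^ k) _)))))
  where
  open ≡-Reasoning
  G = geometricShift s k k
  unfold′ : geometric s k ≈ 1# + const s * (q * G)
  at unfold′ zero = sym (begin
    (1# + const s * (q * G)) 0           ≡⟨ coeff-+ 1# (const s * (q * G)) 0 ⟩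
    1ℤ ℤ.+ (const s * (q * G)) 0         ≡⟨ cong (λ z → 1ℤ ℤ.+ z) (coeff-const* s (q * G) 0) ⟩
    1ℤ ℤ.+ s ℤ.* (q * G) 0               ≡⟨ cong (λ z → 1ℤ ℤ.+ s ℤ.* z) (coeff-q*-zero G) ⟩
    1ℤ ℤ.+ s ℤ.* 0ℤ                      ≡⟨ cong (λ z → 1ℤ ℤ.+ z) (ℤ.*-zeroʳ s) ⟩
    1ℤ                                   ∎)
  at unfold′ (suc n) = sym (begin
    (1# + const s * (q * G)) (suc n)     ≡⟨ coeff-+ 1# (const s * (q * G)) (suc n) ⟩
    0ℤ ℤ.+ (const s * (q * G)) (suc n)   ≡⟨ ℤ.+-identityˡ _ ⟩
    (const s * (q * G)) (suc n)          ≡⟨ coeff-const* s (q * G) (suc n) ⟩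
    s ℤ.* (q * G) (suc n)                ≡⟨ cong (s ℤ.*_) (coeff-q*-suc G n) ⟩
    s ℤ.* G n                            ∎)

geometric-inverse : ∀ {s k} → x ≈ const s * q^ suc k → (1# - x) * geometric s k ≈ 1#
geometric-inverse {x} {s} {k} eq = combine₂ eq (geometric-unfold s k)
  (solve 4 (λ x c m g → (:1 :- x) :* g :- :1 :=
      :- g :* (x :- c :* m) :+ :1 :* (g :- (:1 :+ c :* (m :* g))))
    ≈-refl x (const s) (q^ suc k) (geometric s k))

private
  q^-double : ∀ k → 1# * q^ suc (k ℕ.+ k) ≈ q * Q k
  q^-double k = ≈-trans (*-identityˡ _) (*-congˡ (q^[k+k]≈Q k))

-- `Q (suc k)` is q^(2k+2), and the index of `geometric` is one less than the exponent.
1-Q-inverse : ∀ k → (1# - Q (suc k)) * geometric 1ℤ (suc (k ℕ.+ k)) ≈ 1#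
1-Q-inverse k = geometric-inverse
  (≈-trans (≈-sym (*-congˡ (*-congˡ (q^[k+k]≈Q k)))) (≈-sym (*-identityˡ _)))

1-qQ-unit : ∀ k → Unit (1# - q * Q k)
1-qQ-unit k = geometric 1ℤ (k ℕ.+ k) , geometric-inverse (≈-sym (q^-double k))

1+qQ-unit : ∀ k → Unit (1# + q * Q k)
1+qQ-unit k = geometric -1ℤ (k ℕ.+ k) , ≈-trans
  (*-congʳ (solve 1 (λ x → :1 :+ x := :1 :- con -1ℤ :* x) ≈-refl (q * Q k)))
  (geometric-inverse (*-congˡ (*-congˡ (≈-sym (q^[k+k]≈Q k)))))

1+Q-unit : ∀ k → Unit (1# + Q (suc k))
1+Q-unit k = geometric -1ℤ (suc (k ℕ.+ k)) , ≈-trans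
  (*-congʳ (solve 1 (λ x → :1 :+ x := :1 :- con -1ℤ :* x) ≈-refl (Q (suc k))))
  (geometric-inverse (*-congˡ (*-congˡ (*-congˡ (≈-sym (q^[k+k]≈Q k))))))

-- Finite Jacobi triple products

-- φ k = (Q;Q)ₖ and ι k = 1/(Q;Q)ₖ for Q = q², and Ι M m = 1/(Q;Q)_{M−m},
-- read as 0 when m > M.
φ ι : ℕ → Series
φ zero    = 1#
φ (suc k) = φ k * (1# - Q (suc k))
ι zero    = 1#
ι (suc k) = ι k * geometric 1ℤ (suc (k ℕ.+ k))

Ι : ℕ → ℕ → Series
Ι M       zero    = ι M
Ι zero    (suc m) = 0#
Ι (suc M) (suc m) = Ι M m

-- Q^(M−m); the junk value for m > M is harmless where Ι M m is a factor.
K : ℕ → ℕ → Series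
K M m = Q (M ∸ m)

ι-suc : ∀ k → (1# - Q (suc k)) * ι (suc k) ≈ ι k
ι-suc k = combine₁ (1-Q-inverse k)
  (solve 3 (λ Q i g → (:1 :- Q) :* (i :* g) :- i := i :* ((:1 :- Q) :* g :- :1))
    ≈-refl (Q (suc k)) (ι k) (geometric 1ℤ (suc (k ℕ.+ k))))

-- At m = M the factor is 1 - Q^0 = 0, in agreement with the value 0 that `Ι` takes beyond M.
Ι-suc : ∀ M m → Ι M (suc m) ≈ (1# - K M m) * Ι M m
Ι-suc zero    zero    = solve 0 (:0 := (:1 :- :1) :* :1) ≈-refl
Ι-suc zero    (suc m) = ≈-sym (zeroʳ _)
Ι-suc (suc M) zero    = ≈-sym (ι-suc M)
Ι-suc (suc M) (suc m) = Ι-suc M m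

-- For m ≤ M this is Q^m Q^(M-m) = Q^M; for m > M the factor `Ι M m` makes both sides 0.
Q*K*Ι≈Q*Ι : ∀ M m → Q m * K M m * Ι M m ≈ Q M * Ι M m
Q*K*Ι≈Q*Ι M       zero    = *-congʳ (*-identityˡ (Q M))
Q*K*Ι≈Q*Ι zero    (suc m) = ≈-trans (zeroʳ _) (≈-sym (zeroʳ _))
Q*K*Ι≈Q*Ι (suc M) (suc m) = combine₁ (Q*K*Ι≈Q*Ι M m)
  (solve 5 (λ q u k x I → q :* (q :* u) :* k :* I :- q :* (q :* x) :* I :=
      q :* q :* (u :* k :* I :- x :* I))
    ≈-refl q (Q m) (K M m) (Q M) (Ι M m))

Ι-overflow : ∀ M → Ι M (suc M) ≈ 0#
Ι-overflow zero    = ≈-refl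
Ι-overflow (suc M) = Ι-overflow M

-- The base-Q binomial coefficients [2M+1, M+1+i] and [2M, M+m], divided by (Q;Q)_{2M+1} and
-- (Q;Q)_{2M}.
τ J : ℕ → ℕ → Series
τ M i = Ι M i * ι (suc (i ℕ.+ M))
J M m = Ι M m * ι (m ℕ.+ M)

τ-overflow : ∀ M → τ M (suc M) ≈ 0#
τ-overflow M = ≈-trans (*-congʳ (Ι-overflow M)) (zeroˡ _)

J-overflow : ∀ M → J M (suc M) ≈ 0#
J-overflow M = ≈-trans (*-congʳ (Ι-overflow M)) (zeroˡ _)

J-suc-suc : ∀ M i → J (suc M) (suc i) ≡ Ι M i * ι (suc (suc (i ℕ.+ M)))
J-suc-suc M i = cong (λ k → Ι M i * ι (suc k)) (ℕ.+-suc i M)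

-- With `τ-suc-expand` and `J-suc-suc`, this writes `τ M i`, `τ M (suc i)` and `J (suc M) (suc i)`
-- over the common factor 1/((Q;Q)_{M-i} (Q;Q)_{M+i+2}), so that recurrences among them become
-- polynomial identities.
τ-expand : ∀ M i →
  τ M i ≈ Ι M i * ((1# - q * (q * (q * (q * (Q i * Q M))))) * ι (suc (suc (i ℕ.+ M))))
τ-expand M i = ≈-sym (*-congˡ (≈-trans
  (*-congʳ (+-congˡ (-‿cong (*-congˡ (*-congˡ (*-congˡ (*-congˡ (≈-sym (Q-+ i M)))))))))
  (ι-suc (suc (i ℕ.+ M)))))

τ-suc-expand : ∀ M i →
  τ M (suc i) ≈ (1# - K M i) * Ι M i * ι (suc (suc (i ℕ.+ M)))
τ-suc-expand M i = *-congʳ (Ι-suc M i)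

Q*K*τ≈Q*τ : ∀ M i → Q i * K M i * τ M i ≈ Q M * τ M i
Q*K*τ≈Q*τ M i = combine₁ (Q*K*Ι≈Q*Ι M i)
  (solve 5 (λ u k x I j → u :* k :* (I :* j) :- x :* (I :* j) := j :* (u :* k :* I :- x :* I))
    ≈-refl (Q i) (K M i) (Q M) (Ι M i) (ι (suc (i ℕ.+ M))))

-- Sums Σ q^(i²) over all integers i against the q-binomial coefficients
-- [2M+1, M+1+i] and [2M, M+i], divided by (Q;Q)_{2M+1} and (Q;Q)_{2M} and folded to i ≥ 0.
thetaA thetaB : ℕ → Series
thetaA M = ∑ (λ i → (sq (suc i) + sq i) * τ M i) (suc M)
thetaB M = J M 0 + 2# * ∑ (λ i → sq (suc i) * J M (suc i)) M

-- Passes from the folding used in `thetaA`, by pairs of neighbours, to the one used in `thetaB`.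
∑-adjacent : ∀ f n → ∑ (λ i → f (suc i) + f i) n + f n ≈ f 0 + 2# * ∑ (f ∘ suc) n
∑-adjacent f zero = solve 1 (λ a → :0 :+ a := a :+ :2 :* :0) ≈-refl (f 0)
∑-adjacent f (suc n) = combine₁ (∑-adjacent f n)
  (solve 5 (λ s a z t b → s :+ (b :+ a) :+ b :- (z :+ :2 :* (t :+ b)) :=
      :1 :* (s :+ a :- (z :+ :2 :* t)))
    ≈-refl (∑ (λ i → f (suc i) + f i) n) (f n) (f 0) (∑ (f ∘ suc) n) (f (suc n)))

-- Both Pascal recurrences of the q-binomial coefficient, added.
pascal-J : ∀ M i →
  2# * ((1# - Q (suc M) * Q (suc M)) * J (suc M) (suc i)) ≈
  (1# + K M i) * τ M i + (1# + q * (q * (q * (q * (Q i * Q M))))) * τ M (suc i)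
pascal-J M i rewrite J-suc-suc M i =
  combine₃ (τ-expand M i) (τ-suc-expand M i) (Q*K*Ι≈Q*Ι M i)
    (solve 8 (λ q x u k I j t t′ →
      let z = q :* (q :* (q :* (q :* (u :* x)))) ; y = q :* (q :* x) in
      :2 :* ((:1 :- y :* y) :* (I :* j)) :- ((:1 :+ k) :* t :+ (:1 :+ z) :* t′) :=
      :- (:1 :+ k) :* (t :- I :* ((:1 :- z) :* j)) :+
      :- (:1 :+ z) :* (t′ :- (:1 :- k) :* I :* j) :+
      :2 :* y :* q :* q :* j :* (u :* k :* I :- x :* I))
      ≈-refl q (Q M) (Q i) (K M i) (Ι M i) (ι (suc (suc (i ℕ.+ M)))) (τ M i) (τ M (suc i)))

-- Sums `pascal-J` against q^((i+1)²). The term with Q^(M-i) lowers this weight to q Q^M q^(i²), and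
-- the rest telescopes into a boundary term with `τ M n`, which vanishes at n = M + 1.
thetaB-partial : ∀ M n →
  2# * ((1# - Q (suc M) * Q (suc M)) * ∑ (λ i → sq (suc i) * J (suc M) (suc i)) n) +
    (1# + Q (suc M)) * τ M 0 ≈
  (1# + q * Q M) * ∑ (λ i → (sq (suc i) + sq i) * τ M i) n +
    sq n * (1# + q * (q * (Q n * Q M))) * τ M n
thetaB-partial M zero =
  solve 3 (λ q x t → let y = q :* (q :* x) in
      :2 :* ((:1 :- y :* y) :* :0) :+ (:1 :+ y) :* t :=
      (:1 :+ q :* x) :* :0 :+ :1 :* (:1 :+ q :* (q :* (:1 :* x))) :* t)
    ≈-refl q (Q M) (τ M 0)
thetaB-partial M (suc n) = combine₃ (thetaB-partial M n) (pascal-J M n) (Q*K*τ≈Q*τ M n)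
  (solve 11 (λ q x u k s t t′ t₀ j A B →
      let y = q :* (q :* x) ; u′ = q :* (q :* u) ; s′ = s :* u :* q
          z = q :* (q :* (q :* (q :* (u :* x)))) in
      :2 :* ((:1 :- y :* y) :* (A :+ s′ :* j)) :+ (:1 :+ y) :* t₀ :-
      ((:1 :+ q :* x) :* (B :+ (s′ :+ s) :* t) :+ s′ :* (:1 :+ q :* (q :* (u′ :* x))) :* t′) :=
      :1 :* (:2 :* ((:1 :- y :* y) :* A) :+ (:1 :+ y) :* t₀ :-
        ((:1 :+ q :* x) :* B :+ s :* (:1 :+ q :* (q :* (u :* x))) :* t)) :+
      s′ :* (:2 :* ((:1 :- y :* y) :* j) :- ((:1 :+ k) :* t :+ (:1 :+ z) :* t′)) :+
      s :* q :* (u :* k :* t :- x :* t))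
    ≈-refl q (Q M) (Q n) (K M n) (sq n) (τ M n) (τ M (suc n)) (τ M 0) (J (suc M) (suc n))
    (∑ (λ i → sq (suc i) * J (suc M) (suc i)) n) (∑ (λ i → (sq (suc i) + sq i) * τ M i) n))

thetaB-suc : ∀ M → (1# - Q (suc M) * Q (suc M)) * thetaB (suc M) ≈ (1# + q * Q M) * thetaA M
thetaB-suc M = combine₃ (thetaB-partial M (suc M)) (τ-overflow M) (ι-suc M)
  (solve 9 (λ q x y s u t′ i i′ A →
      (:1 :- y :* y) :* (i′ :* i′ :+ :2 :* A) :- u :=
      :1 :* (:2 :* ((:1 :- y :* y) :* A) :+ (:1 :+ y) :* (i :* i′) :- (u :+ s :* t′)) :+
      s :* (t′ :- :0) :+
      (:1 :+ y) :* i′ :* ((:1 :- y) :* i′ :- i))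
    ≈-refl q (Q M) (Q (suc M)) (sq (suc M) * (1# + q * (q * (Q (suc M) * Q M))))
    ((1# + q * Q M) * thetaA M) (τ M (suc M)) (ι M) (ι (suc M))
    (∑ (λ i → sq (suc i) * J (suc M) (suc i)) (suc M)))

-- `J M i` and `J M (suc i)` are `τ M i` times 1 - Q^(M+i+1) and 1 - Q^(M-i). Against q^(i²) and
-- q^((i+1)²), the subtracted terms become q Q^M times the same two weights, exchanged.
pascal-τ : ∀ M i →
  (1# - q * q * (Q M * Q M)) * ((sq (suc i) + sq i) * τ M i) ≈
  (1# + q * Q M) * (sq (suc i) * J M (suc i) + sq i * J M i)
pascal-τ M i = combine₃ J-expand J-suc-expand (Q*K*τ≈Q*τ M i)
  (solve 8 (λ q x u k s t j j′ → let s′ = s :* u :* q in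
      (:1 :- q :* q :* (x :* x)) :* ((s′ :+ s) :* t) :-
        (:1 :+ q :* x) :* (s′ :* j′ :+ s :* j) :=
      :- (:1 :+ q :* x) :* s :* (j :- (:1 :- q :* (q :* (u :* x))) :* t) :+
      :- (:1 :+ q :* x) :* s′ :* (j′ :- (:1 :- k) :* t) :+
      (:1 :+ q :* x) :* s :* q :* (u :* k :* t :- x :* t))
    ≈-refl q (Q M) (Q i) (K M i) (sq i) (τ M i) (J M i) (J M (suc i)))
  where
  J-expand : J M i ≈ (1# - q * (q * (Q i * Q M))) * τ M i
  J-expand = combine₂ (Q-+ i M) (ι-suc (i ℕ.+ M))
    (solve 6 (λ q v w I j j′ →
        I :* j :- (:1 :- q :* (q :* w)) :* (I :* j′) :=
        :- (q :* q :* I :* j′) :* (v :- w) :+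
        :- I :* ((:1 :- q :* (q :* v)) :* j′ :- j))
      ≈-refl q (Q (i ℕ.+ M)) (Q i * Q M) (Ι M i) (ι (i ℕ.+ M)) (ι (suc (i ℕ.+ M))))
  J-suc-expand : J M (suc i) ≈ (1# - K M i) * τ M i
  J-suc-expand = ≈-trans (*-congʳ (Ι-suc M i)) (*-assoc _ _ _)

thetaA-partial : ∀ M n →
  (1# - q * q * (Q M * Q M)) * ∑ (λ i → (sq (suc i) + sq i) * τ M i) n ≈
  (1# + q * Q M) * ∑ (λ i → sq (suc i) * J M (suc i) + sq i * J M i) n
thetaA-partial M zero    = ≈-trans (zeroʳ _) (≈-sym (zeroʳ _))
thetaA-partial M (suc n) = combine₂ (thetaA-partial M n) (pascal-τ M n)
  (solve 6 (λ a b A B x y →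
      a :* (A :+ x) :- b :* (B :+ y) := :1 :* (a :* A :- b :* B) :+ :1 :* (a :* x :- b :* y))
    ≈-refl (1# - q * q * (Q M * Q M)) (1# + q * Q M)
    (∑ (λ i → (sq (suc i) + sq i) * τ M i) n)
    (∑ (λ i → sq (suc i) * J M (suc i) + sq i * J M i) n)
    ((sq (suc n) + sq n) * τ M n) (sq (suc n) * J M (suc n) + sq n * J M n))

thetaA≈thetaB : ∀ M → (1# - q * q * (Q M * Q M)) * thetaA M ≈ (1# + q * Q M) * thetaB M
thetaA≈thetaB M =
  combine₃ (thetaA-partial M (suc M)) (∑-adjacent (λ m → sq m * J M m) (suc M)) (J-overflow M)
    (solve 7 (λ e b A t s j j₀ →
        e :- b :* (j₀ :+ :2 :* A) :=
        :1 :* (e :- b :* t) :+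
        b :* (t :+ s :* j :- (:1 :* j₀ :+ :2 :* (A :+ s :* j))) :+
        b :* s :* (j :- :0))
      ≈-refl ((1# - q * q * (Q M * Q M)) * thetaA M) (1# + q * Q M)
      (∑ (λ i → sq (suc i) * J M (suc i)) M)
      (∑ (λ i → sq (suc i) * J M (suc i) + sq i * J M i) (suc M))
      (sq (suc M)) (J M (suc M)) (J M 0))

-- The finite Jacobi triple product in the form of a first-order recurrence with product
-- coefficients.
thetaA-suc : ∀ M →
  (1# - q * q * (Q (suc M) * Q (suc M))) * (1# - Q (suc M) * Q (suc M)) * thetaA (suc M) ≈
  (1# + q * Q (suc M)) * (1# + q * Q M) * thetaA M
thetaA-suc M = combine₂ (thetaA≈thetaB (suc M)) (thetaB-suc M)
  (solve 7 (λ a b c d A A′ B →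
      a :* b :* A′ :- c :* d :* A := b :* (a :* A′ :- c :* B) :+ c :* (b :* B :- d :* A))
    ≈-refl (1# - q * q * (Q (suc M) * Q (suc M))) (1# - Q (suc M) * Q (suc M))
    (1# + q * Q (suc M)) (1# + q * Q M) (thetaA M) (thetaA (suc M)) (thetaB (suc M)))

-- Generating functions of signed overpartitions

-- With each part j weighted by the sign (−1)^(j+1), P ℓ generates overpartitions
-- into parts ≤ ℓ, and W ℓ those into parts ≤ ℓ + 1 in which ℓ + 1 is never overlined.
P W : ℕ → Series
P zero    = 1#
P (suc ℓ) = P ℓ + 2# * (const (sgn ℓ) * (q^ suc ℓ * W ℓ))
W ℓ       = geometric (sgn ℓ) ℓ * P ℓ

-- The summand ℓ belongs to the largest part ℓ + 1, which carries no sign and may be overlined or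
-- not, whence the factor 2.
G : ℕ → Series
G = ∑ (λ ℓ → 2# * (q^ suc ℓ * W ℓ))

W-unfold : ∀ ℓ → W ℓ ≈ P ℓ + const (sgn ℓ) * (q^ suc ℓ * W ℓ)
W-unfold ℓ = combine₁ (geometric-unfold (sgn ℓ) ℓ)
  (solve 4 (λ g p c m → g :* p :- (p :+ c :* (m :* (g :* p))) :=
      p :* (g :- (:1 :+ c :* (m :* g))))
    ≈-refl (geometric (sgn ℓ) ℓ) (P ℓ) (const (sgn ℓ)) (q^ suc ℓ))

signed-term-even : ∀ M →
  const (sgn (M ℕ.+ M)) * (q^ suc (M ℕ.+ M) * W (M ℕ.+ M)) ≈ q * Q M * W (M ℕ.+ M)
signed-term-even M = ≈-trans
  (*-cong (reflexive (cong const (sgn-double M))) (*-congʳ (*-congˡ (q^[k+k]≈Q M))))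
  (*-identityˡ _)

signed-term-odd : ∀ M →
  const (sgn (suc (M ℕ.+ M))) * (q^ suc (suc (M ℕ.+ M)) * W (suc (M ℕ.+ M))) ≈
  - (Q (suc M) * W (suc (M ℕ.+ M)))
signed-term-odd M = ≈-trans
  (*-cong (reflexive (cong (λ s → const (ℤ.- s)) (sgn-double M)))
    (*-congʳ (*-congˡ (*-congˡ (q^[k+k]≈Q M)))))
  (solve 1 (λ x → con -1ℤ :* x := :- x) ≈-refl _)

P≈W-even : ∀ M → P (M ℕ.+ M) ≈ (1# - q * Q M) * W (M ℕ.+ M)
P≈W-even M = combine₂ (W-unfold (M ℕ.+ M)) (signed-term-even M)
  (solve 4 (λ x w p t → p :- (:1 :- x) :* w :=
      con -1ℤ :* (w :- (p :+ t)) :+ con -1ℤ :* (t :- x :* w))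
    ≈-refl (q * Q M) (W (M ℕ.+ M)) (P (M ℕ.+ M)) _)

P-odd : ∀ M → P (suc (M ℕ.+ M)) ≈ (1# + q * Q M) * W (M ℕ.+ M)
P-odd M = combine₂ (P≈W-even M) (signed-term-even M)
  (solve 4 (λ x w p t → p :+ :2 :* t :- (:1 :+ x) :* w :=
      :1 :* (p :- (:1 :- x) :* w) :+ :2 :* (t :- x :* w))
    ≈-refl (q * Q M) (W (M ℕ.+ M)) (P (M ℕ.+ M)) _)

P-even-suc : ∀ M → (1# + Q (suc M)) * P (suc M ℕ.+ suc M) ≈ (1# - Q (suc M)) * P (suc (M ℕ.+ M))
P-even-suc M rewrite ℕ.+-suc M M = combine₂ (W-unfold (suc (M ℕ.+ M))) (signed-term-odd M)
  (solve 4 (λ y w p t → (:1 :+ y) :* (p :+ :2 :* t) :- (:1 :- y) :* p :=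
      :- (:2 :* y) :* (w :- (p :+ t)) :+ :2 :* (t :- :- (y :* w)))
    ≈-refl (Q (suc M)) (W (suc (M ℕ.+ M))) (P (suc (M ℕ.+ M))) _)

W-even-suc : ∀ M →
  (1# - q * Q (suc M)) * ((1# + Q (suc M)) * W (suc M ℕ.+ suc M)) ≈
  (1# - Q (suc M)) * (1# + q * Q M) * W (M ℕ.+ M)
W-even-suc M = combine₃ (P≈W-even (suc M)) (P-even-suc M) (P-odd M)
  (solve 7 (λ x y z w w′ p p′ →
      (:1 :- z) :* ((:1 :+ y) :* w′) :- (:1 :- y) :* (:1 :+ x) :* w :=
      :- (:1 :+ y) :* (p′ :- (:1 :- z) :* w′) :+
      :1 :* ((:1 :+ y) :* p′ :- (:1 :- y) :* p) :+
      (:1 :- y) :* (p :- (:1 :+ x) :* w))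
    ≈-refl (q * Q M) (Q (suc M)) (q * Q (suc M)) (W (M ℕ.+ M)) (W (suc M ℕ.+ suc M))
    (P (suc (M ℕ.+ M))) (P (suc M ℕ.+ suc M)))

-- In `thetaA-suc` the factor 1 - q² Q^(2M+2) splits, and 1 + q Q^(M+1) cancels; what remains is the
-- recurrence `W-even-suc`.
φ²thetaA-suc : ∀ M →
  (1# - q * Q (suc M)) * ((1# + Q (suc M)) * (φ (suc M) * φ (suc M) * thetaA (suc M))) ≈
  (1# - Q (suc M)) * (1# + q * Q M) * (φ M * φ M * thetaA M)
φ²thetaA-suc M = cancel (1+qQ-unit (suc M)) (combine₁ (thetaA-suc M)
  (solve 6 (λ q x y f a a′ →
      (:1 :+ q :* y) :*
        ((:1 :- q :* y) :* ((:1 :+ y) :* (f :* (:1 :- y) :* (f :* (:1 :- y)) :* a′))) :-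
      (:1 :+ q :* y) :* ((:1 :- y) :* (:1 :+ q :* x) :* (f :* f :* a)) :=
      f :* f :* (:1 :- y) :*
        ((:1 :- q :* q :* (y :* y)) :* (:1 :- y :* y) :* a′ :-
          (:1 :+ q :* y) :* (:1 :+ q :* x) :* a))
    ≈-refl q (Q M) (Q (suc M)) (φ M) (thetaA M) (thetaA (suc M))))

-- Both sides obey the same first-order recurrence, whose leading factors are units. At M = 0 the
-- equation is 1/(1 - q) = (1 + q)/(1 - q²).
W-even : ∀ M → W (M ℕ.+ M) ≈ φ M * φ M * thetaA M
W-even zero = combine₂ (geometric-unfold 1ℤ 0) (1-Q-inverse 0)
  (solve 3 (λ q w g →
      w :* :1 :- :1 :* :1 :* (:0 :+ (:1 :* :1 :* q :+ :1) :* (:1 :* (:1 :* g))) :=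
      (:1 :+ q) :* g :* (w :- (:1 :+ :1 :* (q :* :1 :* w))) :+
      :- w :* ((:1 :- q :* (q :* :1)) :* g :- :1))
    ≈-refl q (geometric 1ℤ 0) (geometric 1ℤ 1))
W-even (suc M) = cancel (1+Q-unit M) (cancel (1-qQ-unit (suc M))
  (≈-trans (W-even-suc M) (≈-trans (*-congˡ (W-even M)) (≈-sym (φ²thetaA-suc M)))))

-- The finite Hecke-type identity

-- The factor q^(m²) of e m = q^(2m²) Σ_{|d|≤m} q^(−d²), where d = ±m count half, is split
-- off so that the order of e m is visible.
ε e appell : ℕ → Series
ε zero       = 0#
ε (suc m)    = 1# + q * Q m * (ε m + 1#)
e m          = sq m * ε m
appell i     = geometric 1ℤ (suc (i ℕ.+ i)) * ((1# + Q (suc i)) * e (suc i))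

S : ℕ → Series
S M = ∑ (λ i → appell i * (φ M * φ M * J M (suc i))) M

-- Up to the factor (Q;Q)_M², the increment of the i-th term of `S` from M to M + 1.
E : ℕ → ℕ → Series
E M i = e (suc i) * K M i * (1# - Q (suc i) * Q (suc i)) * J (suc M) (suc i)

-- Summation by parts: (1 − Q^(2m)) J (suc M) m is, up to powers of q, a difference of
-- consecutive τ.
E-partial : ∀ M n →
  ∑ (E M) n + e n * (q * (q * Q M) * Q n) * τ M n ≈
  q * Q M * ∑ (λ i → (sq (suc i) + sq i) * τ M i) n
E-partial M zero =
  solve 3 (λ q x t → :0 :+ :1 :* :0 :* (q :* (q :* x) :* :1) :* t := q :* x :* :0)
    ≈-refl q (Q M) (τ M 0)
E-partial M (suc n) = combine₄ (E-partial M n) (τ-expand M n) (τ-suc-expand M n) (Q*K*Ι≈Q*Ι M n)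
  (≈-trans (+-congʳ (+-congʳ (+-congˡ (*-congˡ (reflexive (J-suc-suc M n))))))
  (solve 12 (λ q x u k s ε I j t t′ A B →
      let Y = q :* (q :* x) ; y = q :* (q :* u) ; z = q :* (q :* (q :* (q :* (u :* x))))
          s′ = s :* u :* q ; e = s :* ε ; e′ = s′ :* (:1 :+ q :* u :* (ε :+ :1)) in
      A :+ e′ :* k :* (:1 :- y :* y) :* (I :* j) :+ e′ :* (Y :* y) :* t′ :-
        q :* x :* (B :+ (s′ :+ s) :* t) :=
      :1 :* (A :+ e :* (Y :* u) :* t :- q :* x :* B) :+
      :- (e :* Y :* u :+ q :* x :* (s′ :+ s)) :* (t :- I :* ((:1 :- z) :* j)) :+
      e′ :* (Y :* y) :* (t′ :- (:1 :- k) :* I :* j) :+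
      ((:1 :- z) :* j :* (q :* q :* u :* (e :+ s) :+ s :* q) :- e′ :* j :* y :* q :* q) :*
        (u :* k :* I :- x :* I))
    ≈-refl q (Q M) (Q n) (K M n) (sq n) (ε n) (Ι M n) (ι (suc (suc (n ℕ.+ M))))
    (τ M n) (τ M (suc n)) (∑ (E M) n) (∑ (λ i → (sq (suc i) + sq i) * τ M i) n)))

∑E : ∀ M → ∑ (E M) (suc M) ≈ q * Q M * thetaA M
∑E M = combine₂ (E-partial M (suc M)) (τ-overflow M)
  (solve 4 (λ A B c t → A :- B := :1 :* (A :+ c :* t :- B) :+ :- c :* (t :- :0))
    ≈-refl (∑ (E M) (suc M)) (q * Q M * thetaA M) (e (suc M) * (q * (q * Q M) * Q (suc M)))
    (τ M (suc M)))

J-Pascal : ∀ M i → J M (suc i) ≈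
  (1# - K M i) * Ι M i * ((1# - q * (q * (q * (q * (Q i * Q M))))) * ι (suc (suc (i ℕ.+ M))))
J-Pascal M i = *-cong (Ι-suc M i) (≈-sym (≈-trans
  (*-congʳ (+-congˡ (-‿cong (*-congˡ (*-congˡ (*-congˡ (*-congˡ (≈-sym (Q-+ i M)))))))))
  (ι-suc (suc (i ℕ.+ M)))))

-- (1 - Q^(M+1))² - (1 - Q^(M-i)) (1 - Q^(M+i+2)) = Q^(M-i) (1 - Q^(i+1))², and one factor 1 -
-- Q^(i+1) cancels the denominator of `appell i`.
S-term-suc : ∀ M i →
  appell i * (φ (suc M) * φ (suc M) * J (suc M) (suc i)) ≈
  appell i * (φ M * φ M * J M (suc i)) + φ M * φ M * E M i
S-term-suc M i rewrite J-suc-suc M i = combine₃ (J-Pascal M i) (Q*K*Ι≈Q*Ι M i) (1-Q-inverse i)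
  (solve 10 (λ q x u k I j j′ g e f →
      let Y = q :* (q :* x) ; y = q :* (q :* u) ; z = q :* (q :* (q :* (q :* (u :* x))))
          c = g :* ((:1 :+ y) :* e) in
      c :* (f :* (:1 :- Y) :* (f :* (:1 :- Y)) :* (I :* j)) :-
        (c :* (f :* f :* j′) :+ f :* f :* (e :* k :* (:1 :- y :* y) :* (I :* j))) :=
      :- (c :* f :* f) :* (j′ :- (:1 :- k) :* I :* ((:1 :- z) :* j)) :+
      c :* f :* f :* j :* (:2 :- Y :- y) :* q :* q :* (u :* k :* I :- x :* I) :+
      f :* f :* k :* I :* j :* (:1 :- y) :* (:1 :+ y) :* e :* ((:1 :- y) :* g :- :1))
    ≈-refl q (Q M) (Q i) (K M i) (Ι M i) (ι (suc (suc (i ℕ.+ M)))) (J M (suc i))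
    (geometric 1ℤ (suc (i ℕ.+ i))) (e (suc i)) (φ M))

S-suc-partial : ∀ M n →
  ∑ (λ i → appell i * (φ (suc M) * φ (suc M) * J (suc M) (suc i))) n ≈
  ∑ (λ i → appell i * (φ M * φ M * J M (suc i))) n + φ M * φ M * ∑ (E M) n
S-suc-partial M zero = solve 1 (λ x → :0 := :0 :+ x :* :0) ≈-refl (φ M * φ M)
S-suc-partial M (suc n) = combine₂ (S-suc-partial M n) (S-term-suc M n)
  (solve 7 (λ A B C a b c f →
      A :+ a :- (B :+ b :+ f :* (C :+ c)) :=
      :1 :* (A :- (B :+ f :* C)) :+ :1 :* (a :- (b :+ f :* c)))
    ≈-refl _ _ _ _ _ _ (φ M * φ M))

-- The increments add up to (Q;Q)_M² q Q^M `thetaA M`, which is q Q^M `W (M + M)`. The summand i =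
-- M, absent from `S M`, is 0 by `J-overflow`.
S-suc : ∀ M → S (suc M) ≈ S M + q * Q M * W (M ℕ.+ M)
S-suc M = combine₄ (S-suc-partial M (suc M)) (∑E M) (J-overflow M) (W-even M)
  (solve 9 (λ S S′ c f j e x a w →
      S′ :- (S :+ x :* w) :=
      :1 :* (S′ :- (S :+ c :* (f :* j) :+ f :* e)) :+ f :* (e :- x :* a) :+
      c :* f :* (j :- :0) :+ :- x :* (w :- f :* a))
    ≈-refl (S M) (S (suc M)) (appell M) (φ M * φ M) (J M (suc M)) (∑ (E M) (suc M))
    (q * Q M) (thetaA M) (W (M ℕ.+ M)))

-- In G + P the steps from even ℓ = 2M double to 4 q Q^M W(2M) = 4 (S(M+1) - S(M)), and those from
-- odd ℓ cancel because the even part ℓ + 1 has sign -1.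
G-even : ∀ M → G (M ℕ.+ M) ≈ 2# * 2# * S M - P (M ℕ.+ M) + 1#
G-even zero = solve 0 (:0 := :2 :* :2 :* :0 :- :1 :+ :1) ≈-refl
G-even (suc M) = subst (λ k → G k ≈ 2# * 2# * S (suc M) - P k + 1#)
  (sym (cong suc (ℕ.+-suc M M)))
  (combine₄ (G-even M) (S-suc M)
    (+-cong (*-congʳ (*-congˡ (q^[k+k]≈Q M))) (signed-term-even M))
    (+-cong (*-congʳ (*-congˡ (*-congˡ (q^[k+k]≈Q M)))) (signed-term-odd M))
    (solve 10 (λ G S S′ P m₀ t₀ m₁ t₁ A B →
        G :+ :2 :* m₀ :+ :2 :* m₁ :- (:2 :* :2 :* S′ :- (P :+ :2 :* t₀ :+ :2 :* t₁) :+ :1) :=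
        :1 :* (G :- (:2 :* :2 :* S :- P :+ :1)) :+
        :- (:2 :* :2) :* (S′ :- (S :+ A)) :+
        :2 :* (m₀ :+ t₀ :- (A :+ A)) :+
        :2 :* (m₁ :+ t₁ :- (B :+ :- B)))
      ≈-refl (G (M ℕ.+ M)) (S M) (S (suc M)) (P (M ℕ.+ M))
      (q^ suc (M ℕ.+ M) * W (M ℕ.+ M)) _ (q^ suc (suc (M ℕ.+ M)) * W (suc (M ℕ.+ M))) _
      (q * Q M * W (M ℕ.+ M)) (Q (suc M) * W (suc (M ℕ.+ M)))))

-- Truncation and positivity

infix 4 _≈_[mod_]
_≈_[mod_] : Series → Series → Series → Set
f ≈ g [mod d ] = ∃[ r ] f ≈ g + d * r

∑-mod : ∀ {d} (f g : ℕ → Series) n → (∀ i → i < n → f i ≈ g i [mod d ]) → ∑ f n ≈ ∑ g n [mod d ]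
∑-mod {d} f g zero _ = 0# , solve 1 (λ d → :0 := :0 :+ d :* :0) ≈-refl d
∑-mod {d} f g (suc n) f≈g =
  let r  , p  = ∑-mod f g n (λ i i<n → f≈g i (ℕ.m<n⇒m<1+n i<n))
      r′ , p′ = f≈g n ℕ.≤-refl
  in r + r′ , ≈-trans (+-cong p p′)
  (solve 5 (λ a b d r r′ → a :+ d :* r :+ (b :+ d :* r′) := a :+ b :+ d :* (r :+ r′))
    ≈-refl (∑ g n) (g n) d r r′)

φι : ∀ M → φ M * ι M ≈ 1#
φι zero = *-identityˡ 1#
φι (suc M) = combine₂ (φι M) (ι-suc M)
  (solve 4 (λ f i i′ y → f :* (:1 :- y) :* i′ :- :1 :=
      :1 :* (f :* i :- :1) :+ f :* ((:1 :- y) :* i′ :- i))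
    ≈-refl (φ M) (ι M) (ι (suc M)) (Q (suc M)))

K-suc : ∀ {M i} → i < M → K M i ≡ q * (q * K M (suc i))
K-suc {suc M} {zero}  _         = refl
K-suc {suc M} {suc i} (s≤s i<M) = K-suc i<M

Q*K≈Q : ∀ {M i} → i ≤ M → Q i * K M i ≈ Q M
Q*K≈Q {M} {i} i≤M = ≈-trans (≈-sym (Q-+ i (M ∸ i))) (reflexive (cong Q (ℕ.m+[n∸m]≡n i≤M)))

-- The quotient (Q;Q)_M / (Q;Q)_{M-i} is the product of 1 - Q^j over M - i < j ≤ M.
φΙ≈1 : ∀ {M} i → i ≤ M → φ M * Ι M i ≈ 1# [mod q * (q * K M i) ]
φΙ≈1 {M} zero _ = 0# , ≈-trans (φι M) (solve 1 (λ d → :1 := :1 :+ d :* :0) ≈-refl _)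
φΙ≈1 {M} (suc i) i<M = let r , p = φΙ≈1 {M} i (ℕ.<⇒≤ i<M) in
  q * q * r - 1# - q * q * K M i * r ,
  combine₃ p (Ι-suc M i) (reflexive (K-suc i<M))
    (solve 7 (λ q f k k′ I I′ r →
        f :* I′ :- (:1 :+ q :* (q :* k′) :* (q :* q :* r :- :1 :- q :* q :* k :* r)) :=
        (:1 :- k) :* (f :* I :- (:1 :+ q :* (q :* k) :* r)) :+
        f :* (I′ :- (:1 :- k) :* I) :+
        (q :* q :* r :- :1 :- q :* q :* k :* r) :* (k :- q :* (q :* k′)))
      ≈-refl q (φ M) (K M i) (K M (suc i)) (Ι M i) (Ι M (suc i)) r)

-- The quotient (Q;Q)_M / (Q;Q)_{M+j} is the inverse of the product of 1 - Q^l over M < l ≤ M + j.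
φι≈1 : ∀ M j → φ M * ι (j ℕ.+ M) ≈ 1# [mod Q (suc M) ]
φι≈1 M zero = 0# , ≈-trans (φι M) (solve 1 (λ d → :1 := :1 :+ d :* :0) ≈-refl _)
φι≈1 M (suc j) = let r , p = φι≈1 M j in
  (Q j + r) * γ ,
  combine₃ p (1-Q-inverse (j ℕ.+ M)) (Q-+ j M)
    (solve 8 (λ q f u x v i g r → let Y = q :* (q :* x) in
        f :* (i :* g) :- (:1 :+ Y :* ((u :+ r) :* g)) :=
        g :* (f :* i :- (:1 :+ Y :* r)) :+
        :1 :* ((:1 :- q :* (q :* v)) :* g :- :1) :+
        q :* q :* g :* (v :- u :* x))
      ≈-refl q (φ M) (Q j) (Q M) (Q (j ℕ.+ M)) (ι (j ℕ.+ M)) γ r)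
  where γ = geometric 1ℤ (suc ((j ℕ.+ M) ℕ.+ (j ℕ.+ M)))

-- For i ≤ M the modulus Q^(M+1) of `φι≈1` is Q^i times the modulus Q^(M-i+1) of `φΙ≈1`, so the two
-- congruences multiply.
φ²Ιι≈1 : ∀ {M i} j → i ≤ M → φ M * φ M * (Ι M i * ι (j ℕ.+ M)) ≈ 1# [mod q * (q * K M i) ]
φ²Ιι≈1 {M} {i} j i≤M =
  let r , p = φΙ≈1 i i≤M ; r′ , p′ = φι≈1 M j in
  r + Q i * r′ * (1# + q * q * K M i * r) ,
  combine₃ p p′ (Q*K≈Q i≤M)
    (solve 9 (λ q f k I j x u r r′ → let a = :1 :+ q :* (q :* k) :* r in
        f :* f :* (I :* j) :- (:1 :+ q :* (q :* k) :* (r :+ u :* r′ :* (:1 :+ q :* q :* k :* r))) :=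
        f :* j :* (f :* I :- a) :+
        a :* (f :* j :- (:1 :+ q :* (q :* x) :* r′)) :+
        :- (q :* q :* r′ :* a) :* (u :* k :- x))
      ≈-refl q (φ M) (K M i) (Ι M i) (ι (j ℕ.+ M)) (Q M) (Q i) r r′)

-- i² + 2(M - i + 1) = (i - 1)² + 2M + 1, so the cofactor is q^((i-1)²).
sq*K : ∀ {M i} → i ≤ M → sq i * (q * (q * K M i)) ≈ 0# [mod q * Q M ]
sq*K {M} {zero} _ = q ,
  solve 2 (λ q x → :1 :* (q :* (q :* x)) := :0 :+ q :* x :* q) ≈-refl q (Q M)
sq*K {M} {suc n} n<M = sq n , combine₂ (Q*K≈Q (ℕ.<⇒≤ n<M)) (reflexive (K-suc n<M))
  (solve 6 (λ q s u x k k′ →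
      s :* u :* q :* (q :* (q :* k′)) :- (:0 :+ q :* x :* s) :=
      s :* q :* (u :* k :- x) :+ :- (s :* u :* q) :* (k :- q :* (q :* k′)))
    ≈-refl q (sq n) (Q n) (Q M) (K M n) (K M (suc n)))

-- The order of sq i makes up for that of the error term of the weight.
weight≈1 : ∀ {M i} j c → i ≤ M →
  c * sq i * (φ M * φ M * (Ι M i * ι (j ℕ.+ M))) ≈ c * sq i [mod q * Q M ]
weight≈1 {M} {i} j c i≤M =
  let r , p = φ²Ιι≈1 j i≤M ; r′ , p′ = sq*K i≤M in
  c * r′ * r , combine₂ p p′
  (solve 7 (λ w c s k d r r′ →
      c :* s :* w :- (c :* s :+ d :* (c :* r′ :* r)) :=
      c :* s :* (w :- (:1 :+ k :* r)) :+ c :* r :* (s :* k :- (:0 :+ d :* r′)))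
    ≈-refl (φ M * φ M * (Ι M i * ι (j ℕ.+ M))) c (sq i) (q * (q * K M i)) (q * Q M) r r′)

S≈∑appell : ∀ M → S M ≈ ∑ appell M [mod q * Q M ]
S≈∑appell M = ∑-mod _ _ M term
  where
  term : ∀ i → i < M → appell i * (φ M * φ M * J M (suc i)) ≈ appell i [mod q * Q M ]
  term i i<M =
    let r , p = weight≈1 (suc i)
          (geometric 1ℤ (suc (i ℕ.+ i)) * ((1# + Q (suc i)) * ε (suc i))) i<M
    in r , combine₁ p
    (solve 6 (λ g y s ε w dr →
        g :* (y :* (s :* ε)) :* w :- (g :* (y :* (s :* ε)) :+ dr) :=
        :1 :* (g :* (y :* ε) :* s :* w :- (g :* (y :* ε) :* s :+ dr)))
      ≈-refl (geometric 1ℤ (suc (i ℕ.+ i))) (1# + Q (suc i)) (sq (suc i)) (ε (suc i))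
      (φ M * φ M * J M (suc i)) (q * Q M * r))

W-even≈∑sq : ∀ M → W (M ℕ.+ M) ≈ 1# + 2# * ∑ (sq ∘ suc) M [mod q * Q M ]
W-even≈∑sq M =
  let r , p = ∑-mod (λ i → φ M * φ M * ((sq (suc i) + sq i) * τ M i))
        (λ i → sq (suc i) + sq i) (suc M) term
  -- Folding leaves one unpaired q^((M+1)²), which is q Q^M times `sq M`.
  in sq M + r , combine₃ p (∑-adjacent sq (suc M))
    (≈-trans (W-even M) (∑-distribˡ (φ M * φ M) (λ i → (sq (suc i) + sq i) * τ M i) (suc M)))
  (solve 8 (λ q x w A B T s r →
      w :- (:1 :+ :2 :* T :+ q :* x :* (s :+ r)) :=
      :1 :* (A :- (B :+ q :* x :* r)) :+
      :1 :* (B :+ s :* x :* q :- (:1 :+ :2 :* (T :+ s :* x :* q))) :+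
      :1 :* (w :- A))
    ≈-refl q (Q M) (W (M ℕ.+ M)) _ (∑ (λ i → sq (suc i) + sq i) (suc M)) (∑ (sq ∘ suc) M) (sq M) r)
  where
  term : ∀ i → i < suc M →
    φ M * φ M * ((sq (suc i) + sq i) * τ M i) ≈ sq (suc i) + sq i [mod q * Q M ]
  term i (s≤s i≤M) = let r , p = weight≈1 (suc i) (Q i * q + 1#) i≤M in
    r , combine₁ p
    (solve 6 (λ q u s w t dr →
        w :* ((s :* u :* q :+ s) :* t) :- (s :* u :* q :+ s :+ dr) :=
        :1 :* ((u :* q :+ :1) :* s :* (w :* t) :- ((u :* q :+ :1) :* s :+ dr)))
      ≈-refl q (Q i) (sq i) (φ M * φ M) (τ M i) (q * Q M * r))

hecke : ℕ → Series
hecke i = 2# * 2# * appell i - 2# * sq (suc i)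

-- Modulo q Q^M, `S M` reduces to the sum of `appell`, and P = (1 - q Q^M) W reduces to W, hence to
-- 1 plus twice the sum of the squares' powers; the 1 cancels in `G-even`.
G-even≈∑hecke : ∀ M → G (M ℕ.+ M) ≈ ∑ hecke M [mod q * Q M ]
G-even≈∑hecke M =
  let r , p = S≈∑appell M ; r′ , p′ = W-even≈∑sq M in
  2# * 2# * r - r′ + W (M ℕ.+ M) ,
  combine₅ (G-even M) p p′ (P≈W-even M) (∑hecke M)
    (solve 10 (λ G S P W A T H d r r′ →
        G :- (H :+ d :* (:2 :* :2 :* r :- r′ :+ W)) :=
        :1 :* (G :- (:2 :* :2 :* S :- P :+ :1)) :+
        :2 :* :2 :* (S :- (A :+ d :* r)) :+
        con -1ℤ :* (W :- (:1 :+ :2 :* T :+ d :* r′)) :+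
        con -1ℤ :* (P :- (:1 :- d) :* W) :+
        con -1ℤ :* (H :- (:2 :* :2 :* A :- :2 :* T)))
      ≈-refl (G (M ℕ.+ M)) (S M) (P (M ℕ.+ M)) (W (M ℕ.+ M)) (∑ appell M) (∑ (sq ∘ suc) M)
      (∑ hecke M) (q * Q M) r r′)
  where
  ∑hecke : ∀ n → ∑ hecke n ≈ 2# * 2# * ∑ appell n - 2# * ∑ (sq ∘ suc) n
  ∑hecke zero = solve 0 (:0 := :2 :* :2 :* :0 :- :2 :* :0) ≈-refl
  ∑hecke (suc n) = combine₁ (∑hecke n)
    (solve 5 (λ H A T a s →
        H :+ (:2 :* :2 :* a :- :2 :* s) :- (:2 :* :2 :* (A :+ a) :- :2 :* (T :+ s)) :=
        :1 :* (H :- (:2 :* :2 :* A :- :2 :* T)))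
      ≈-refl (∑ hecke n) (∑ appell n) (∑ (sq ∘ suc) n) (appell n) (sq (suc n)))

-- Series with nonnegative coefficients

NonNeg : Series → Set
NonNeg f = ∀ n → 0ℤ ℤ.≤ f n

nonNeg-resp-≈ : f ≈ g → NonNeg g → NonNeg f
nonNeg-resp-≈ f≈g 0≤g n = subst (0ℤ ℤ.≤_) (sym (at f≈g n)) (0≤g n)

0≤*⁺ : ∀ {i j} → 0ℤ ℤ.≤ i → 0ℤ ℤ.≤ j → 0ℤ ℤ.≤ i ℤ.* j
0≤*⁺ {+ m} {+ n} _ _ = subst (0ℤ ℤ.≤_) (ℤ.pos-* m n) (ℤ.+≤+ z≤n)

opaque
  unfolding _+_

  nonNeg-+ : NonNeg f → NonNeg g → NonNeg (f + g)
  nonNeg-+ 0≤f 0≤g n = ℤ.+-mono-≤ (0≤f n) (0≤g n)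

  nonNeg-* : NonNeg f → NonNeg g → NonNeg (f * g)
  nonNeg-* 0≤f 0≤g zero    = 0≤*⁺ (0≤f 0) (0≤g 0)
  nonNeg-* 0≤f 0≤g (suc n) =
    ℤ.+-mono-≤ (0≤*⁺ (0≤f 0) (0≤g (suc n))) (nonNeg-* (0≤f ∘ suc) 0≤g n)

nonNeg-const : ∀ n → NonNeg (const (+ n))
nonNeg-const n zero    = ℤ.+≤+ z≤n
nonNeg-const n (suc _) = ℤ.≤-refl

nonNeg-q : NonNeg q
nonNeg-q zero          = ℤ.≤-refl
nonNeg-q (suc zero)    = ℤ.+≤+ z≤n
nonNeg-q (suc (suc _)) = ℤ.≤-refl

nonNeg-geometricShift : ∀ k j → NonNeg (geometricShift 1ℤ k j)
nonNeg-geometricShift k zero    zero    = ℤ.+≤+ z≤n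
nonNeg-geometricShift k zero    (suc n) = 0≤*⁺ {1ℤ} (ℤ.+≤+ z≤n) (nonNeg-geometricShift k k n)
nonNeg-geometricShift k (suc j) zero    = ℤ.≤-refl
nonNeg-geometricShift k (suc j) (suc n) = nonNeg-geometricShift k j n

nonNeg-Q : ∀ k → NonNeg (Q k)
nonNeg-Q zero    = nonNeg-const 1
nonNeg-Q (suc k) = nonNeg-* nonNeg-q (nonNeg-* nonNeg-q (nonNeg-Q k))

nonNeg-sq : ∀ k → NonNeg (sq k)
nonNeg-sq zero    = nonNeg-const 1
nonNeg-sq (suc k) = nonNeg-* (nonNeg-* (nonNeg-sq k) (nonNeg-Q k)) nonNeg-q

nonNeg-ε : ∀ k → NonNeg (ε k)
nonNeg-ε zero    = nonNeg-const 0
nonNeg-ε (suc k) = nonNeg-+ (nonNeg-const 1)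
  (nonNeg-* (nonNeg-* nonNeg-q (nonNeg-Q k)) (nonNeg-+ (nonNeg-ε k) (nonNeg-const 1)))

nonNeg-hecke : ∀ i → NonNeg (hecke i)
nonNeg-hecke i = nonNeg-resp-≈ hecke≈
  (nonNeg-* (nonNeg-* (nonNeg-const 2) (nonNeg-sq (suc i)))
    (nonNeg-+ (nonNeg-const 1) (nonNeg-* (nonNeg-const 2)
      (nonNeg-+ nonNeg-w (nonNeg-* (nonNeg-* (nonNeg-* (nonNeg-const 2) (nonNeg-Q (suc i)))
        (nonNeg-geometricShift _ 0)) (nonNeg-+ (nonNeg-const 1) nonNeg-w))))))
  where
  γ = geometric 1ℤ (suc (i ℕ.+ i))
  w = q * Q i * (ε i + 1#)
  nonNeg-w : NonNeg w
  nonNeg-w = nonNeg-* (nonNeg-* nonNeg-q (nonNeg-Q i)) (nonNeg-+ (nonNeg-ε i) (nonNeg-const 1))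
  -- With m = i + 1, (1 + Q^m)/(1 - Q^m) = 1 + 2 Q^m/(1 - Q^m) and `ε (suc i)` = 1 + w, so the
  -- leading 4 q^(m²) absorbs the negative term -2 q^(m²).
  hecke≈ : hecke i ≈ 2# * sq (suc i) * (1# + 2# * (w + 2# * Q (suc i) * γ * (1# + w)))
  hecke≈ = combine₁ (1-Q-inverse i)
    (solve 4 (λ g y s w →
        :2 :* :2 :* (g :* ((:1 :+ y) :* (s :* (:1 :+ w)))) :- :2 :* s :-
          :2 :* s :* (:1 :+ :2 :* (w :+ :2 :* y :* g :* (:1 :+ w))) :=
        :2 :* :2 :* s :* (:1 :+ w) :* ((:1 :- y) :* g :- :1))
      ≈-refl γ (Q (suc i)) (sq (suc i)) w)

alternating-ones : ∀ n → geometric 1ℤ 1 (suc n) ℤ.+ geometric 1ℤ 1 n ≡ 1ℤ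
alternating-ones zero    = refl
alternating-ones (suc n) =
  trans (cong (ℤ._+ geometric 1ℤ 1 (suc n)) (ℤ.*-identityˡ (geometric 1ℤ 1 n)))
    (trans (ℤ.+-comm (geometric 1ℤ 1 n) (geometric 1ℤ 1 (suc n))) (alternating-ones n))

-- `hecke 0` is 4q(1 + q²)/(1 - q) - 2q. With v = (1 + q)/(1 - q²) = 1/(1 - q), it splits into A =
-- q/(1 - q), whose coefficients are 1 from q onwards, and a nonnegative remainder B.
hecke₀-positive : ∀ n → 0ℤ ℤ.< hecke 0 (suc n)
hecke₀-positive n = subst (0ℤ ℤ.<_) (sym (at hecke₀≈ (suc n)))
  (subst (0ℤ ℤ.<_) (sym (coeff-+ A B (suc n))) (ℤ.+-mono-<-≤ (A-positive n) (nonNeg-B (suc n))))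
  where
  γ = geometric 1ℤ 1
  v = γ + q * γ
  A = q + q * (q * v)
  B = q + q * (q * (const (+ 3) * v + 2# * 2# * (q * v)))
  nonNeg-v : NonNeg v
  nonNeg-v = nonNeg-+ (nonNeg-geometricShift 1 0) (nonNeg-* nonNeg-q (nonNeg-geometricShift 1 0))
  nonNeg-B : NonNeg B
  nonNeg-B = nonNeg-+ nonNeg-q (nonNeg-* nonNeg-q (nonNeg-* nonNeg-q
    (nonNeg-+ (nonNeg-* (nonNeg-const 3) nonNeg-v)
      (nonNeg-* (nonNeg-* (nonNeg-const 2) (nonNeg-const 2)) (nonNeg-* nonNeg-q nonNeg-v)))))
  v-ones : ∀ n → v n ≡ 1ℤ
  v-ones zero    = trans (coeff-+ γ (q * γ) 0) (cong (λ z → 1ℤ ℤ.+ z) (coeff-q*-zero γ))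
  v-ones (suc n) = trans (coeff-+ γ (q * γ) (suc n))
    (trans (cong (λ z → γ (suc n) ℤ.+ z) (coeff-q*-suc γ n)) (alternating-ones n))
  A-ones : ∀ n → A (suc n) ≡ 1ℤ
  A-ones zero    = trans (coeff-+ q (q * (q * v)) 1)
    (cong (λ z → 1ℤ ℤ.+ z) (trans (coeff-q*-suc (q * v) 0) (coeff-q*-zero v)))
  A-ones (suc n) = trans (coeff-+ q (q * (q * v)) (2 ℕ.+ n))
    (cong (λ z → 0ℤ ℤ.+ z) (trans (coeff-q*-suc (q * v) (suc n))
      (trans (coeff-q*-suc v n) (v-ones n))))
  A-positive : ∀ n → 0ℤ ℤ.< A (suc n)
  A-positive n = subst (0ℤ ℤ.<_) (sym (A-ones n)) (ℤ.+<+ (s≤s z≤n))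
  hecke₀≈ : hecke 0 ≈ A + B
  hecke₀≈ = combine₁ (1-Q-inverse 0)
    (solve 2 (λ q g →
        let v = g :+ q :* g in
        :2 :* :2 :* (g :* ((:1 :+ q :* (q :* :1)) :*
          (:1 :* :1 :* q :* (:1 :+ q :* :1 :* (:0 :+ :1))))) :- :2 :* (:1 :* :1 :* q) :-
        (q :+ q :* (q :* v) :+ (q :+ q :* (q :* (con (+ 3) :* v :+ :2 :* :2 :* (q :* v))))) :=
        :2 :* :2 :* q :* ((:1 :- q :* (q :* :1)) :* g :- :1))
      ≈-refl q γ)

∑hecke-positive : ∀ M n → 0ℤ ℤ.< ∑ hecke (suc M) (suc n)
∑hecke-positive zero n =
  subst (0ℤ ℤ.<_) (sym (at (+-identityˡ (hecke 0)) (suc n))) (hecke₀-positive n)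
∑hecke-positive (suc M) n =
  subst (0ℤ ℤ.<_) (sym (coeff-+ (∑ hecke (suc M)) (hecke (suc M)) (suc n)))
  (ℤ.+-mono-<-≤ (∑hecke-positive M n) (nonNeg-hecke (suc M) (suc n)))

G-positive : ∀ M n → n ≤ M → 0ℤ ℤ.< G (suc M ℕ.+ suc M) (suc n)
G-positive M n n≤M = subst (0ℤ ℤ.<_) (sym coeff-G) (∑hecke-positive M n)
  where
  error = proj₁ (G-even≈∑hecke (suc M))
  vanishes : (q * Q (suc M) * error) (suc n) ≡ 0ℤ
  vanishes = trans (at (*-congʳ (*-congˡ (≈-sym (q^[k+k]≈Q (suc M))))) (suc n))
    -- The error term has order at least 2M + 3, which exceeds n + 1.
    (coeff-q^*-< {suc (suc M ℕ.+ suc M)} error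
      (s≤s (ℕ.≤-trans (s≤s n≤M) (ℕ.m≤m+n (suc M) (suc M)))))
  coeff-G : G (suc M ℕ.+ suc M) (suc n) ≡ ∑ hecke (suc M) (suc n)
  coeff-G = trans (at (proj₂ (G-even≈∑hecke (suc M))) (suc n))
    (trans (coeff-+ (∑ hecke (suc M)) (q * Q (suc M) * error) (suc n))
      (trans (cong (λ z → ∑ hecke (suc M) (suc n) ℤ.+ z) vanishes) (ℤ.+-identityʳ _)))

-- Overpartition sums as coefficients

term : ℕ → Series
term i = q^ suc i * W i

term-≤ : ∀ {i n} → suc i ≤ n → term i n ≡ W i (n ∸ suc i)
term-≤ {i} {n} i<n = subst (λ m → term i m ≡ W i (n ∸ suc i)) (ℕ.m+[n∸m]≡n i<n)
  (coeff-q^*-+ (suc i) (n ∸ suc i) (W i))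

coeff-P-suc : ∀ i n → P (suc i) n ≡ P i n ℤ.+ + 2 ℤ.* (sgn i ℤ.* term i n)
coeff-P-suc i n = trans (coeff-+ (P i) (2# * (const (sgn i) * term i)) n)
  (cong (λ z → P i n ℤ.+ z) (trans (coeff-const* (+ 2) (const (sgn i) * term i) n)
    (cong (+ 2 ℤ.*_) (coeff-const* (sgn i) (term i) n))))

coeff-W : ∀ i n → W i n ≡ P i n ℤ.+ sgn i ℤ.* term i n
coeff-W i n = trans (at (W-unfold i) n) (trans (coeff-+ (P i) (const (sgn i) * term i) n)
  (cong (λ z → P i n ℤ.+ z) (coeff-const* (sgn i) (term i) n)))

coeff-G-suc : ∀ i n → G (suc i) n ≡ G i n ℤ.+ + 2 ℤ.* term i n
coeff-G-suc i n = trans (coeff-+ (G i) (2# * term i) n)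
  (cong (λ z → G i n ℤ.+ z) (coeff-const* (+ 2) (term i) n))

P-constant-term : ∀ i → P i 0 ≡ 1ℤ
P-constant-term zero    = refl
P-constant-term (suc i) = trans (coeff-P-suc i 0) (trans
  (cong₂ (λ x y → x ℤ.+ + 2 ℤ.* (sgn i ℤ.* y)) (P-constant-term i)
    (coeff-q^*-< {suc i} (W i) (s≤s z≤n)))
  (cong (λ z → 1ℤ ℤ.+ + 2 ℤ.* z) (ℤ.*-zeroʳ (sgn i))))

W-constant-term : ∀ i → W i 0 ≡ 1ℤ
W-constant-term i = trans (coeff-W i 0) (trans
  (cong₂ (λ x y → x ℤ.+ sgn i ℤ.* y) (P-constant-term i) (coeff-q^*-< {suc i} (W i) (s≤s z≤n)))
  (cong (λ z → 1ℤ ℤ.+ z) (ℤ.*-zeroʳ (sgn i))))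

-- The induction step of `tails`, by the size of the first part after p. Sizes below that of p occur
-- with both flags and build up `P L`; the size of p itself occurs only without overline, which
-- completes `W L`; larger sizes give 0.
module _ {k n N L : ℕ} {b₀ : Bool} (n≤1+k : n ≤ suc k) (L<N : L < N)
  (tails : ∀ m i b → m ≤ k → i < N →
    sumOver (tailWeight (suc i , b) m) (listsUpTo k (partsUpTo N)) ≡ W i m) where
  private
    p : Part
    p = suc L , b₀

    block : Bool → ℕ → ℤ
    block b j = sumOver (λ xs → tailWeight p n ((j , b) ∷ xs)) (listsUpTo k (partsUpTo N))

    block-no : ∀ b j → ¬ ((1 ≤ j × j ≤ n) × p ≽ (j , b)) → block b j ≡ 0ℤ
    block-no b j ¬ok =
      sumOver-all-zero (λ xs → tailWeight-∷-no {n} p xs ¬ok) (listsUpTo k (partsUpTo N))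

    block-yes : ∀ b i → i < N → p ≽ (suc i , b) → block b (suc i) ≡ sgn i ℤ.* term i n
    block-yes b i i<N p≽ = by-cases (suc i ≤? n)
      where
      by-cases : Dec (suc i ≤ n) → block b (suc i) ≡ sgn i ℤ.* term i n
      by-cases (no i≮n) = trans (block-no b (suc i) (i≮n ∘ proj₂ ∘ proj₁))
        (sym (trans (cong (sgn i ℤ.*_) (coeff-q^*-< {suc i} (W i) (ℕ.≰⇒> i≮n)))
          (ℤ.*-zeroʳ (sgn i))))
      by-cases (yes i<n) = begin
        block b (suc i)
          ≡⟨ sumOver-cong (λ xs → tailWeight-∷-yes {n} p xs ((s≤s z≤n , i<n) , p≽)) lists ⟩
        sumOver (λ xs → sgn (suc (suc i)) ℤ.* tailWeight (suc i , b) (n ∸ suc i) xs) lists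
          ≡⟨ sumOver-scale (sgn (suc (suc i))) (tailWeight (suc i , b) (n ∸ suc i)) lists ⟩
        sgn (suc (suc i)) ℤ.* sumOver (tailWeight (suc i , b) (n ∸ suc i)) lists
          -- The part i + 1 has sign (-1)^(i+2) = (-1)^i.
          ≡⟨ cong₂ ℤ._*_ (ℤ.neg-involutive (sgn i)) (tails (n ∸ suc i) i b n-i≤k i<N) ⟩
        sgn i ℤ.* W i (n ∸ suc i)
          ≡⟨ cong (sgn i ℤ.*_) (term-≤ i<n) ⟨
        sgn i ℤ.* term i n ∎
        where
        open ≡-Reasoning
        lists = listsUpTo k (partsUpTo N)
        n-i≤k : n ∸ suc i ≤ k
        n-i≤k = ℕ.≤-trans (ℕ.∸-monoˡ-≤ (suc i) n≤1+k) (ℕ.m∸n≤m k i)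

    blocks : ℕ → ℤ
    blocks j = block false j ℤ.+ block true j

    -- `1# n` accounts for the empty tail, which is valid only for n = 0.
    smaller : ∀ i → i ≤ L → 1# n ℤ.+ sumOver blocks (upTo (suc i)) ≡ P i n
    smaller zero _ = trans (cong (λ z → 1# n ℤ.+ z)
      (cong₂ (λ x y → x ℤ.+ y ℤ.+ 0ℤ) (block-no false 0 (λ { ((() , _) , _) }))
        (block-no true 0 (λ { ((() , _) , _) }))))
      (ℤ.+-identityʳ (1# n))
    smaller (suc i) i<L = begin
      1# n ℤ.+ sumOver blocks (upTo (suc (suc i)))
        ≡⟨ cong (λ z → 1# n ℤ.+ z) (sumOver-upTo-suc blocks (suc i)) ⟩
      1# n ℤ.+ (sumOver blocks (upTo (suc i)) ℤ.+ blocks (suc i))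
        ≡⟨ ℤ.+-assoc (1# n) _ _ ⟨
      1# n ℤ.+ sumOver blocks (upTo (suc i)) ℤ.+ blocks (suc i)
        ≡⟨ cong₂ ℤ._+_ (smaller i (ℕ.<⇒≤ i<L)) (cong₂ ℤ._+_ (yes′ false) (yes′ true)) ⟩
      P i n ℤ.+ (sgn i ℤ.* term i n ℤ.+ sgn i ℤ.* term i n)
        ≡⟨ cong (λ z → P i n ℤ.+ z) (2*≡+ (sgn i ℤ.* term i n)) ⟨
      P i n ℤ.+ + 2 ℤ.* (sgn i ℤ.* term i n)
        ≡⟨ coeff-P-suc i n ⟨
      P (suc i) n ∎
      where
      open ≡-Reasoning
      yes′ : ∀ b → block b (suc i) ≡ sgn i ℤ.* term i n
      yes′ b = block-yes b i (ℕ.<-trans i<L L<N)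
        (ℕ.<⇒≤ (s≤s i<L) , λ eq → contradiction (ℕ.suc-injective eq) (ℕ.<⇒≢ i<L))

    up-to-p : 1# n ℤ.+ sumOver blocks (upTo (suc (suc L))) ≡ W L n
    up-to-p = begin
      1# n ℤ.+ sumOver blocks (upTo (suc (suc L)))
        ≡⟨ cong (λ z → 1# n ℤ.+ z) (sumOver-upTo-suc blocks (suc L)) ⟩
      1# n ℤ.+ (sumOver blocks (upTo (suc L)) ℤ.+ blocks (suc L))
        ≡⟨ ℤ.+-assoc (1# n) _ _ ⟨
      1# n ℤ.+ sumOver blocks (upTo (suc L)) ℤ.+ blocks (suc L)
        ≡⟨ cong₂ ℤ._+_ (smaller L ℕ.≤-refl)
             (cong₂ ℤ._+_ (block-yes false L L<N (ℕ.≤-refl , λ _ → refl))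
               (block-no true (suc L) (λ (_ , _ , flag) → contradiction (flag refl) (λ ())))) ⟩
      P L n ℤ.+ (sgn L ℤ.* term L n ℤ.+ 0ℤ)
        ≡⟨ cong (λ z → P L n ℤ.+ z) (ℤ.+-identityʳ _) ⟩
      P L n ℤ.+ sgn L ℤ.* term L n
        ≡⟨ coeff-W L n ⟨
      W L n ∎
      where open ≡-Reasoning

    beyond-p : ∀ m → 1# n ℤ.+ sumOver blocks (upTo (m ℕ.+ suc (suc L))) ≡ W L n
    beyond-p zero    = up-to-p
    beyond-p (suc m) = trans
      (cong (λ z → 1# n ℤ.+ z) (trans (sumOver-upTo-suc blocks (m ℕ.+ suc (suc L)))
        (trans (cong (λ z → sumOver blocks (upTo (m ℕ.+ suc (suc L))) ℤ.+ z)
          (cong₂ ℤ._+_ (too-large false) (too-large true))) (ℤ.+-identityʳ _))))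
      (beyond-p m)
      where
      too-large : ∀ b → block b (m ℕ.+ suc (suc L)) ≡ 0ℤ
      too-large b = block-no b _ (λ (_ , ≤L , _) → ℕ.<⇒≱ (ℕ.m≤n+m (suc (suc L)) m) ≤L)

  tails-suc : sumOver (tailWeight (suc L , b₀) n) (listsUpTo (suc k) (partsUpTo N)) ≡ W L n
  tails-suc = begin
    sumOver (tailWeight p n) (listsUpTo (suc k) (partsUpTo N))
      ≡⟨ listsUpTo-suc-sum (tailWeight p n) k N ⟩
    tailWeight p n [] ℤ.+ sumOver blocks (upTo (suc N))
      ≡⟨ cong₂ (λ z m → z ℤ.+ sumOver blocks (upTo m)) (tailWeight-[] n) suc-N ⟩
    1# n ℤ.+ sumOver blocks (upTo (N ∸ suc L ℕ.+ suc (suc L)))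
      ≡⟨ beyond-p (N ∸ suc L) ⟩
    W L n ∎
    where
    open ≡-Reasoning
    tailWeight-[] : ∀ n → tailWeight p n [] ≡ 1# n
    tailWeight-[] zero    = refl
    tailWeight-[] (suc n) = refl
    suc-N : suc N ≡ N ∸ suc L ℕ.+ suc (suc L)
    suc-N = sym (trans (ℕ.+-suc (N ∸ suc L) (suc L)) (cong suc (ℕ.m∸n+n≡m L<N)))

tails : ∀ k {N} n L b → n ≤ k → L < N →
  sumOver (tailWeight (suc L , b) n) (listsUpTo k (partsUpTo N)) ≡ W L n
tails zero    zero L b _   _   = sym (W-constant-term L)
tails (suc k) n    L b n≤k L<N = tails-suc n≤k L<N (λ m i b m≤k i<N → tails k m i b m≤k i<N)

-- The head is the largest part: either flag gives the same unsigned contribution, which matches the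
-- factor 2 in `G`.
overpartition-sum : ∀ n →
  sumOver (headedWeight (suc n)) (listsUpTo (suc n) (partsUpTo (suc n))) ≡ G (suc n) (suc n)
overpartition-sum n′ = trans (listsUpTo-suc-sum (headedWeight n) n′ n)
  (trans (ℤ.+-identityˡ _) (partial n ℕ.≤-refl))
  where
  n = suc n′
  lists = listsUpTo n′ (partsUpTo n)

  block : Bool → ℕ → ℤ
  block b j = sumOver (λ xs → headedWeight n ((j , b) ∷ xs)) lists

  block-zero : ∀ b → block b 0 ≡ 0ℤ
  block-zero b = sumOver-all-zero (λ _ → refl) lists

  block-suc : ∀ b i → i < n → block b (suc i) ≡ term i n
  block-suc b i i<n = trans
    (sumOver-cong (λ xs → if-yes (fits? n (suc i , b)) (s≤s z≤n , i<n)) lists)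
    (trans (tails n′ (n ∸ suc i) i b (ℕ.m∸n≤m n′ i) i<n) (sym (term-≤ i<n)))

  blocks : ℕ → ℤ
  blocks j = block false j ℤ.+ block true j

  partial : ∀ i → i ≤ n → sumOver blocks (upTo (suc i)) ≡ G i n
  partial zero    _   = cong₂ (λ x y → x ℤ.+ y ℤ.+ 0ℤ) (block-zero false) (block-zero true)
  partial (suc i) i<n = begin
    sumOver blocks (upTo (suc (suc i)))
      ≡⟨ sumOver-upTo-suc blocks (suc i) ⟩
    sumOver blocks (upTo (suc i)) ℤ.+ blocks (suc i)
      ≡⟨ cong₂ ℤ._+_ (partial i (ℕ.<⇒≤ i<n))
           (cong₂ ℤ._+_ (block-suc false i i<n) (block-suc true i i<n)) ⟩
    G i n ℤ.+ (term i n ℤ.+ term i n)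
      ≡⟨ cong (λ z → G i n ℤ.+ z) (2*≡+ (term i n)) ⟨
    G i n ℤ.+ + 2 ℤ.* term i n
      ≡⟨ coeff-G-suc i n ⟨
    G (suc i) n ∎
    where open ≡-Reasoning

-- A largest part above n cannot contribute to q^n. This moves the coefficient to the even index n +
-- n, where `G-positive` applies.
G-stable : ∀ n m → G (m ℕ.+ n) n ≡ G n n
G-stable n zero    = refl
G-stable n (suc m) = trans (coeff-G-suc (m ℕ.+ n) n)
  (trans (cong₂ (λ x y → x ℤ.+ + 2 ℤ.* y) (G-stable n m)
    (coeff-q^*-< {suc (m ℕ.+ n)} (W (m ℕ.+ n)) (s≤s (ℕ.m≤n+m n m))))
  (ℤ.+-identityʳ _))

overpartition-sum-positive : ∀ n →
  0ℤ ℤ.< sumOver (headedWeight (suc n)) (listsUpTo (suc n) (partsUpTo (suc n)))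
overpartition-sum-positive n = subst (0ℤ ℤ.<_)
  (trans (G-stable (suc n) (suc n)) (sym (overpartition-sum n)))
  (G-positive n n ℕ.≤-refl)

theorem3 : (n : ℕ) → n ≥ 1 →
    (¬ (2 ∣ n) → N̄ 0 2 n > N̄ 1 2 n) ×
    (2 ∣ n → N̄ 0 2 n < N̄ 1 2 n)
theorem3 n@(suc n′) n≥1 = odd , even
  where
  total = sumOver (headedWeight n) (listsUpTo n (partsUpTo n))
  difference : ∀ {s} → sgn n ≡ s → + N̄ 0 2 n ℤ.- + N̄ 1 2 n ≡ ℤ.- s ℤ.* total
  difference refl = N̄-difference n n≥1
  odd : ¬ (2 ∣ n) → N̄ 0 2 n > N̄ 1 2 n
  odd 2∤n = ℤ.drop‿+<+ (0<i-j⇒j<i (subst (0ℤ ℤ.<_)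
    (sym (trans (difference (2∤⇒sgn≡-1 n 2∤n)) (ℤ.*-identityˡ total)))
    (overpartition-sum-positive n′)))
  even : 2 ∣ n → N̄ 0 2 n < N̄ 1 2 n
  even 2∣n = ℤ.drop‿+<+ (0<i-j⇒j<i (subst (0ℤ ℤ.<_)
    (sym (trans (i-j≡-[j-i] (+ N̄ 1 2 n) (+ N̄ 0 2 n))
      (trans (cong ℤ.-_ (difference (2∣⇒sgn≡1 n 2∣n))) (-[-1*i]≡i total))))
    (overpartition-sum-positive n′)))
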